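{- Let $d\ge1$ be an integer dividing $q+1$ and let $k$ be an integer with $1\le k<d$. Let \[\zeta=\pi_F(1-y^{q-1})^{ -k/d}\sum_{m=0}^\infty(-1)^m\binom{k/d}{m}y^{(q-1)m}\left[\frac{(1-y)^{\mu_m}-1}{\mu_m\,y}\right]\in K[[y]],\qquad \mu_m:=1+\frac{qk}{d}-(q-1)m.\] Then the coefficients of $\zeta$ are unbounded (with respect to the absolute value of $K$).
   Context: $F$ is a finite extension of $\mathbb{Q}_p$ with uniformiser $\pi_F$ and residue field of size $q$; $K$ is a complete field extension of $F$. For $\alpha\in\mathbb{Z}_p$, $(1-y)^\alpha=\sum_n\binom{\alpha}{n}(-y)^n\in\mathbb{Z}_p[[y]]$ denotes the binomial series and $\binom{\alpha}{n}=\alpha(\alpha-1)\cdots(\alpha-n+1)/n!$; since $k/d\notin\mathbb{Z}$ and $d\mid q+1$, each $\mu_m$ is a non-zero element of $\mathbb{Z}_p$, and each bracket is a power series in $y$. -}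

module Defs where

open import Data.Nat as ℕ using (ℕ; zero; suc; NonZero; _≤ᵇ_)
open import Data.Integer as ℤ using (ℤ; +_)
open import Data.Rational using (ℚ; _+_; _*_; _-_; -_; _/_; 0ℚ; 1ℚ)
open import Data.Bool using (if_then_else_)

sgn : ℕ → ℚ
sgn zero = 1ℚ
sgn (suc n) = - sgn n

ι : ℕ → ℚ
ι n = (+ n) / 1

binom : ℚ → ℕ → ℚ
binom α zero = 1ℚ
binom α (suc n) = binom α n * (α - ι n) * ((+ 1) / suc n)

Σ< : ℕ → (ℕ → ℚ) → ℚ
Σ< zero f = 0ℚ
Σ< (suc n) f = Σ< n f + f n

frac : (k d : ℕ) → .{{NonZero d}} → ℚ
frac k d = (+ k) / d

μ : (q k d : ℕ) → .{{NonZero d}} → ℕ → ℚ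
μ q k d m = 1ℚ + ι q * frac k d - ι (q ℕ.∸ 1) * ι m

-- coefficient of y^j in the bracket [((1-y)^μ - 1)/(μ y)], namely
-- (-1)^(j+1) binom(μ, j+1) / μ, written in the division-free form
-- (-1)^(j+1) (μ-1)(μ-2)⋯(μ-j) / (j+1)!   (valid since μ ≠ 0)
fallFrom1 : ℚ → ℕ → ℚ
fallFrom1 α zero = 1ℚ
fallFrom1 α (suc j) = fallFrom1 α j * (α - ι (suc j))

invFact : ℕ → ℚ
invFact zero = 1ℚ
invFact (suc n) = invFact n * ((+ 1) / suc n)

bracketCoeff : ℚ → ℕ → ℚ
bracketCoeff α j = sgn (suc j) * fallFrom1 α j * invFact (suc j)

-- coefficient of y^n in ζ / π_F :
--   (1 - y^(q-1))^(-k/d) = Σ_a (-1)^a binom(-k/d, a) y^((q-1)a)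
--   times Σ_m (-1)^m binom(k/d, m) y^((q-1)m) [bracket_m]
-- Indices a, m range over 0..n (enough since q - 1 ≥ 1); terms with
-- (q-1)(a+m) > n contribute nothing.
zetaCoeff : (q k d : ℕ) → .{{NonZero d}} → ℕ → ℚ
zetaCoeff q k d n =
  Σ< (suc n) λ a → Σ< (suc n) λ m →
    if ((q ℕ.∸ 1) ℕ.* (a ℕ.+ m)) ≤ᵇ n
    then sgn a * binom (- frac k d) a * sgn m * binom (frac k d) m
         * bracketCoeff (μ q k d m) (n ℕ.∸ ((q ℕ.∸ 1) ℕ.* (a ℕ.+ m)))
    else 0ℚ

{-# OPTIONS --safe #-}
module Submission where

-- Write α = k/d = c/(q+1) and r = q-1.  Multiplying ζ/π by (1-y^r)^α gives a
-- series whose coefficients g n = Σ_m (-1)^m C(α,m) [bracket_m]_{n-rm} are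
-- explicit, and ζ has bounded coefficients only if g does.  Up to sign the m-th
-- summand of g n is C(α,m) C(qα-rm, i-1) / i with i = n+1-rm.  For n+1 = p^L + r m₀,
-- with m₀ < p^L and r m₀ ≡ 1+qα mod p^L, the index m₀ is the only one with p^L ∣ i,
-- and its second binomial coefficient is a unit.  By Kummer's theorem, C(α,m₀) has
-- valuation equal to the number of carries, i.e. of positions j ≤ L with
-- m₀ mod p^j > α mod p^j, and for the other summands the carries in the first v(i)
-- positions still count; so if position L carries nothing, the m₀-th summand strictly
-- dominates and v(g n) = -(number of carry-free positions).  This number is unbounded
-- because the digits of α and of (1+qα)/(q-1) are periodic with a carry-free position
-- in each period.

-- Periodicity is turned into polynomial identities. For a power Q of q, the residue A of c/(q+1)
-- modulo Q satisfies (q+1) A = c + x Q with x the residue of -c/Q modulo q+1, and y is likewise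
-- determined modulo q^2-1. Since q^2 is 1 for both moduli, x and y depend only on the parity of the
-- exponent: x = q+1-c for even exponents, x = c for odd ones. As A is about xQ/(q+1) and m₀ about
-- yQ/(q^2-1), the absence of a carry, m₀ ≤ A, comes down to y ≤ x (q-1). Neither parity achieves
-- this for every c, whence the case distinction; one solution then yields infinitely many levels.
-- Everything p-adic happens inside ℚ: ℤ_p is replaced by ℤ_(p), and valuations by equality up to
-- units of ℤ_(p), which keeps its meaning when both sides vanish.

module CarryFreeLevels where

  open import Data.Nat
  open import Data.Nat.Properties
  open import Data.Nat.Solver
  open +-*-Solver using (solve; con; _:=_; _:+_; _:*_)
  open import Data.Product using (∃; _,_)
  open import Relation.Binary.Definitions using (tri<; tri≈; tri>)
  open import Relation.Binary.PropositionalEquality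
  open ≡-Reasoning

  ≤-by : ∀ {m n} k → m + k ≡ n → m ≤ n
  ≤-by {m} k eq = ≤-trans (m≤m+n m k) (≤-reflexive eq)

  -- Q₀ is a power of q = r+1, and A₀, m₀ are the residues modulo Q₀ of c/(q+1) and of
  -- (q+1+qc)/(q²-1), that is, of α and of (1+qα)/(q-1).  The same x and y then solve both
  -- equations for Q₀ q², Q₀ q⁴, ….
  record Seed (r c : ℕ) : Set where
    field
      exponent x y A₀ m₀ : ℕ
    q = suc r
    Q₀ = q ^ exponent
    field
      A₀<Q₀ : A₀ < Q₀
      m₀≤A₀ : m₀ ≤ A₀
      x≤q+1 : x ≤ suc q
      y≤x*r : y ≤ x * r
      A₀-eq : suc q * A₀ ≡ c + x * Q₀
      m₀-eq : r * suc q * m₀ ≡ suc q + q * c + y * Q₀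

  -- Explicit carry-free levels

  seed-small : ∀ c s → Seed (suc c + 1 + s) (suc c)
  seed-small c s = record
    { exponent = 2
    -- Write C for `suc c`, so that s = q-2-C. An even power of q is 1 modulo q^2-1, hence x = q+1-C
    -- and y = (q^2-1) - (q+1+qC) = q (q-1-C) - 2; in terms of s these have no subtraction.
    ; x = s + 3
    ; y = (suc c + s + 2) * s + suc c + s
    ; A₀ = 1 + (s + 3) * (suc c + 1 + s)
    ; m₀ = 1 + ((suc c + s + 2) * s + suc c + s)
    ; A₀<Q₀ = ≤-by ((1 + c) * (1 + c) + (1 + c) * s + c)
        (solve 2 (λ c s → let C = con 1 :+ c; r = C :+ con 1 :+ s; q = con 1 :+ r in
          con 1 :+ (con 1 :+ (s :+ con 3) :* r) :+ (C :* C :+ C :* s :+ c) := q :* (q :* con 1)) refl c s)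
    ; m₀≤A₀ = s≤s y≤
    ; x≤q+1 = ≤-by (suc c) (solve 2 (λ c s → let C = con 1 :+ c; r = C :+ con 1 :+ s in
          s :+ con 3 :+ C := con 2 :+ r) refl c s)
    ; y≤x*r = y≤
    ; A₀-eq = solve 2 (λ c s → let C = con 1 :+ c; r = C :+ con 1 :+ s; q = con 1 :+ r in
          (con 1 :+ q) :* (con 1 :+ (s :+ con 3) :* r) := C :+ (s :+ con 3) :* (q :* (q :* con 1))) refl c s
    ; m₀-eq = solve 2 (λ c s → let C = con 1 :+ c; r = C :+ con 1 :+ s; q = con 1 :+ r; y = (C :+ s :+ con 2) :* s :+ C :+ s in
          r :* (con 1 :+ q) :* (con 1 :+ y) := con 1 :+ q :+ q :* C :+ y :* (q :* (q :* con 1))) refl c s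
    }
    where
    y≤ : (suc c + s + 2) * s + suc c + s ≤ (s + 3) * (suc c + 1 + s)
    y≤ = ≤-by (2 * (1 + c) + s + 3) (solve 2 (λ c s → let C = con 1 :+ c; r = C :+ con 1 :+ s in
          (C :+ s :+ con 2) :* s :+ C :+ s :+ (con 2 :* C :+ s :+ con 3) := (s :+ con 3) :* r) refl c s)

  -- An odd power of q is q modulo q^2-1, which is its own inverse, so x = c and y ≡ -(q+1+c), that
  -- is, y = q^2-q-2-c with q = s+3. The same formulas with c = q give `seed-q`.
  seed-q-1 : ∀ s → Seed (s + 2) (s + 2)
  seed-q-1 s = record
    { exponent = 3
    ; x = s + 2
    ; y = s * s + 4 * s + 2
    ; A₀ = (s + 2) * (suc (s + 2) * (s + 2) + 1)
    ; m₀ = s + 2 + (s * s + 4 * s + 2) * suc (s + 2)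
    ; A₀<Q₀ = ≤-by (2 * (s + 2) * (s + 2) + 2 * (s + 2)) (solve 1 (λ s → let r = s :+ con 2; q = con 1 :+ r in
          con 1 :+ r :* (q :* r :+ con 1) :+ (con 2 :* r :* r :+ con 2 :* r) := q :* (q :* (q :* con 1))) refl s)
    ; m₀≤A₀ = ≤-by (2 * suc (s + 2)) (solve 1 (λ s → let r = s :+ con 2; q = con 1 :+ r in
          r :+ (s :* s :+ con 4 :* s :+ con 2) :* q :+ con 2 :* q := r :* (q :* r :+ con 1)) refl s)
    ; x≤q+1 = m≤n⇒m≤1+n (n≤1+n (s + 2))
    ; y≤x*r = ≤-by 2 (solve 1 (λ s → s :* s :+ con 4 :* s :+ con 2 :+ con 2 := (s :+ con 2) :* (s :+ con 2)) refl s)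
    ; A₀-eq = solve 1 (λ s → let r = s :+ con 2; q = con 1 :+ r in
          (con 1 :+ q) :* (r :* (q :* r :+ con 1)) := r :+ r :* (q :* (q :* (q :* con 1)))) refl s
    ; m₀-eq = solve 1 (λ s → let r = s :+ con 2; q = con 1 :+ r; y = s :* s :+ con 4 :* s :+ con 2 in
          r :* (con 1 :+ q) :* (r :+ y :* q) := con 1 :+ q :+ q :* r :+ y :* (q :* (q :* (q :* con 1)))) refl s
    }

  seed-q : ∀ s → Seed (s + 2) (suc (s + 2))
  seed-q s = record
    { exponent = 3
    ; x = suc (s + 2)
    ; y = s * s + 4 * s + 1
    ; A₀ = suc (s + 2) * (suc (s + 2) * (s + 2) + 1)
    ; m₀ = s + 2 + (s * s + 4 * s + 1) * suc (s + 2)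
    ; A₀<Q₀ = ≤-by ((s + 2) * (s + 2) + s + 1) (solve 1 (λ s → let r = s :+ con 2; q = con 1 :+ r in
          con 1 :+ q :* (q :* r :+ con 1) :+ (r :* r :+ s :+ con 1) := q :* (q :* (q :* con 1))) refl s)
    ; m₀≤A₀ = ≤-by (suc (s + 2) * (s + 5) + 1) (solve 1 (λ s → let r = s :+ con 2; q = con 1 :+ r in
          r :+ (s :* s :+ con 4 :* s :+ con 1) :* q :+ (q :* (s :+ con 5) :+ con 1) := q :* (q :* r :+ con 1)) refl s)
    ; x≤q+1 = n≤1+n (suc (s + 2))
    ; y≤x*r = ≤-by (s + 5) (solve 1 (λ s → s :* s :+ con 4 :* s :+ con 1 :+ (s :+ con 5) := (con 1 :+ (s :+ con 2)) :* (s :+ con 2)) refl s)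
    ; A₀-eq = solve 1 (λ s → let r = s :+ con 2; q = con 1 :+ r in
          (con 1 :+ q) :* (q :* (q :* r :+ con 1)) := q :+ q :* (q :* (q :* (q :* con 1)))) refl s
    ; m₀-eq = solve 1 (λ s → let r = s :+ con 2; q = con 1 :+ r; y = s :* s :+ con 4 :* s :+ con 1 in
          r :* (con 1 :+ q) :* (r :+ y :* q) := con 1 :+ q :+ q :* q :+ y :* (q :* (q :* (q :* con 1)))) refl s
    }

  seed-2-1 : Seed 1 1
  seed-2-1 = record
    { exponent = 2 ; x = 2 ; y = 1 ; A₀ = 3 ; m₀ = 3
    ; A₀<Q₀ = ≤-refl ; m₀≤A₀ = ≤-refl ; x≤q+1 = n≤1+n 2 ; y≤x*r = n≤1+n 1
    ; A₀-eq = refl ; m₀-eq = refl }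

  seed-2-2 : Seed 1 2
  seed-2-2 = record
    { exponent = 3 ; x = 2 ; y = 1 ; A₀ = 6 ; m₀ = 5
    ; A₀<Q₀ = n≤1+n 7 ; m₀≤A₀ = n≤1+n 5 ; x≤q+1 = n≤1+n 2 ; y≤x*r = n≤1+n 1
    ; A₀-eq = refl ; m₀-eq = refl }

  -- The even powers of q are carry-free for c ≤ q-2, the odd ones for c ≥ q-1; for q = 2
  -- the witnesses are different because y has to be reduced modulo q²-1.
  seed : ∀ r c → 1 ≤ r → 1 ≤ c → c ≤ suc r → Seed r c
  seed 1 1 _ _ _ = seed-2-1
  seed 1 2 _ _ _ = seed-2-2
  seed 1 (suc (suc (suc _))) _ _ (s≤s (s≤s ()))
  seed r@(suc (suc s)) c@(suc c-1) _ _ c≤q with <-cmp c r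
  ... | tri≈ _ refl _ = subst (λ r → Seed r r) (+-comm s 2) (seed-q-1 s)
  ... | tri> _ _ r<c  = subst₂ Seed (+-comm s 2) (trans (cong suc (+-comm s 2)) (≤-antisym r<c c≤q)) (seed-q s)
  ... | tri< c<r _ _  = subst (λ r → Seed r c)
    (trans (cong (_+ (r ∸ suc c)) (+-comm c 1)) (m+[n∸m]≡n c<r)) (seed-small c-1 (r ∸ suc c))

  -- From one carry-free level to infinitely many

  module Tower {r c} (σ : Seed r c) where
    open Seed σ

    -- Replacing Q by q^2 Q with x and y fixed adds x Q (q^2-1) to (q+1) A and y Q (q^2-1) to r
    -- (q+1) m; dividing, with q^2-1 = r (q+1), gives the increments.
    Q A m : ℕ → ℕ
    Q zero    = Q₀
    Q (suc t) = q ^ 2 * Q t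
    A zero    = A₀
    A (suc t) = A t + Q t * (x * r)
    m zero    = m₀
    m (suc t) = m t + Q t * y

    -- Since 1 + (q+1) r = q^2 and x ≤ q+1, the increment leaves room for one more `Q t` below
    -- `Q (suc t)`.
    A<Q : ∀ t → A t < Q t
    A<Q zero    = A₀<Q₀
    A<Q (suc t) = <-≤-trans (+-monoˡ-< (Q t * (x * r)) (A<Q t))
      (≤-trans (≤-reflexive (sym (*-suc (Q t) (x * r))))
      (≤-trans (*-monoʳ-≤ (Q t) (s≤s (*-monoˡ-≤ r x≤q+1)))
      (≤-reflexive (solve 2 (λ Q r → let q = con 1 :+ r in Q :* (con 1 :+ (con 1 :+ q) :* r) := q :* (q :* con 1) :* Q) refl (Q t) r))))

    m≤A : ∀ t → m t ≤ A t
    m≤A zero    = m₀≤A₀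
    m≤A (suc t) = +-mono-≤ (m≤A t) (*-monoʳ-≤ (Q t) y≤x*r)

    A-eq : ∀ t → suc q * A t ≡ c + x * Q t
    A-eq zero    = A₀-eq
    A-eq (suc t) = begin
      suc q * (A t + Q t * (x * r))            ≡⟨ *-distribˡ-+ (suc q) (A t) _ ⟩
      suc q * A t + suc q * (Q t * (x * r))    ≡⟨ cong (_+ suc q * (Q t * (x * r))) (A-eq t) ⟩
      c + x * Q t + suc q * (Q t * (x * r))    ≡⟨ solve 4 (λ c x Q r → let q = con 1 :+ r in c :+ x :* Q :+ (con 1 :+ q) :* (Q :* (x :* r)) := c :+ x :* (q :* (q :* con 1) :* Q)) refl c x (Q t) r ⟩
      c + x * Q (suc t)                        ∎

    m-eq : ∀ t → r * suc q * m t ≡ suc q + q * c + y * Q t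
    m-eq zero    = m₀-eq
    m-eq (suc t) = begin
      r * suc q * (m t + Q t * y)                          ≡⟨ *-distribˡ-+ (r * suc q) (m t) _ ⟩
      r * suc q * m t + r * suc q * (Q t * y)              ≡⟨ cong (_+ r * suc q * (Q t * y)) (m-eq t) ⟩
      suc q + q * c + y * Q t + r * suc q * (Q t * y)      ≡⟨ solve 4 (λ s y Q r → let q = con 1 :+ r in s :+ y :* Q :+ r :* (con 1 :+ q) :* (Q :* y) := s :+ y :* (q :* (q :* con 1) :* Q)) refl (suc q + q * c) y (Q t) r ⟩
      suc q + q * c + y * Q (suc t)                        ∎

    Q-multiple : ∀ s d → ∃ λ w → Q (d + s) ≡ Q s * w
    Q-multiple s zero    = 1 , sym (*-identityʳ (Q s))
    Q-multiple s (suc d) with Q-multiple s d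
    ... | w , eq = q ^ 2 * w , trans (cong (q ^ 2 *_) eq) (solve 3 (λ a b c → a :* (b :* c) := b :* (a :* c)) refl (q ^ 2) (Q s) w)

    module Congruent (B : ℕ → ℕ) (b : ℕ) (B-suc : ∀ t → B (suc t) ≡ B t + Q t * b) where

      congruent : ∀ s d → ∃ λ z → B (d + s) ≡ B s + Q s * z
      congruent s zero    = 0 , sym (trans (cong (B s +_) (*-zeroʳ (Q s))) (+-identityʳ (B s)))
      congruent s (suc d) with congruent s d | Q-multiple s d
      ... | z , B≡ | w , Q≡ = z + w * b , (begin
        B (suc d + s)                          ≡⟨ B-suc (d + s) ⟩
        B (d + s) + Q (d + s) * b              ≡⟨ cong₂ (λ u v → u + v * b) B≡ Q≡ ⟩
        B s + Q s * z + Q s * w * b            ≡⟨ solve 5 (λ B Q z w b → B :+ Q :* z :+ Q :* w :* b := B :+ Q :* (z :+ w :* b)) refl (B s) (Q s) z w b ⟩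
        B s + Q s * (z + w * b)                ∎)

    -- All levels are truncations of one digit sequence, so a carry-free position found at level s
    -- remains visible from every higher level.
    A-congruent : ∀ s d → ∃ λ z → A (d + s) ≡ A s + Q s * z
    A-congruent = Congruent.congruent A (x * r) (λ _ → refl)

    m-congruent : ∀ s d → ∃ λ z → m (d + s) ≡ m s + Q s * z
    m-congruent = Congruent.congruent m y (λ _ → refl)

module Integrality where

  open import Defs
  open import Data.Nat as ℕ using (ℕ; zero; suc; NonZero; z≤n; s≤s; _≤ᵇ_)
  import Data.Nat.Properties as ℕₚ
  import Data.Nat.Divisibility as ℕ
  import Data.Nat.DivMod as ℕ
  open import Data.Nat.GCD using (module Bézout)
  open import Data.Nat.Coprimality using (Coprime; coprime-Bézout)
  open import Data.Nat.Primality using (Prime; euclidsLemma; prime⇒nonZero; prime⇒nonTrivial; prime⇒irreducible)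
  open import Data.Integer as ℤ using (ℤ; +_; ∣_∣)
  import Data.Integer.Properties as ℤₚ
  import Data.Integer.Divisibility.Signed as ℤ
  import Data.Integer.DivMod as ℤ
  import Data.Integer.Solver as ℤ
  open ℤ.+-*-Solver using () renaming (solve to solveℤ; _:+_ to _⊕_; _:*_ to _⊗_; :-_ to ⊝_; _:=_ to _⊜_; con to conℤ)
  open import Data.Rational using (ℚ; _+_; _*_; _-_; -_; _/_; 0ℚ; 1ℚ; toℚᵘ)
  open import Data.Rational.Properties
  import Data.Rational.Unnormalised as ℚᵘ
  import Data.Rational.Unnormalised.Properties as ℚᵘ
  open import Data.Rational.Solver
  open +-*-Solver using (solve; con; _:=_; _:+_; _:*_; _:-_; :-_)
  open import Data.Bool using (Bool; true; false; not; if_then_else_; T)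
  open import Data.Product using (∃; ∃₂; _×_; _,_; proj₁; proj₂)
  open import Data.Sum using (inj₁; inj₂; [_,_]′)
  open import Data.Empty using (⊥; ⊥-elim)
  open import Relation.Nullary using (¬_; Dec; yes; no)
  open import Relation.Nullary.Decidable using (⌊_⌋)
  open import Relation.Binary.Definitions using (tri<; tri≈; tri>)
  open import Relation.Binary.PropositionalEquality hiding ([_])
  open ≡-Reasoning

  open CarryFreeLevels using (Seed; module Seed; module Tower)

  -- Integers inside ℚ

  ιℤ : ℤ → ℚ
  ιℤ z = z / 1

  toℚᵘ-ι : ∀ z → toℚᵘ (ιℤ z) ℚᵘ.≃ ℚᵘ.mkℚᵘ z 0
  toℚᵘ-ι z = toℚᵘ-fromℚᵘ (ℚᵘ.mkℚᵘ z 0)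

  ιℤ-+ : ∀ x y → ιℤ (x ℤ.+ y) ≡ ιℤ x + ιℤ y
  ιℤ-+ x y = toℚᵘ-injective (ℚᵘ.≃-trans (toℚᵘ-ι (x ℤ.+ y)) (ℚᵘ.≃-trans
    (ℚᵘ.*≡* (cong (ℤ._* ℤ.1ℤ) (cong₂ ℤ._+_ (sym (ℤₚ.*-identityʳ x)) (sym (ℤₚ.*-identityʳ y)))))
    (ℚᵘ.≃-sym (ℚᵘ.≃-trans (toℚᵘ-homo-+ (ιℤ x) (ιℤ y)) (ℚᵘ.+-cong (toℚᵘ-ι x) (toℚᵘ-ι y))))))

  ιℤ-* : ∀ x y → ιℤ (x ℤ.* y) ≡ ιℤ x * ιℤ y
  ιℤ-* x y = toℚᵘ-injective (ℚᵘ.≃-trans (toℚᵘ-ι (x ℤ.* y)) (ℚᵘ.≃-trans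
    (ℚᵘ.*≡* refl)
    (ℚᵘ.≃-sym (ℚᵘ.≃-trans (toℚᵘ-homo-* (ιℤ x) (ιℤ y)) (ℚᵘ.*-cong (toℚᵘ-ι x) (toℚᵘ-ι y))))))

  ιℤ-injective : ∀ {x y} → ιℤ x ≡ ιℤ y → x ≡ y
  ιℤ-injective {x} {y} eq with ℚᵘ.≃-trans (ℚᵘ.≃-sym (toℚᵘ-ι x)) (ℚᵘ.≃-trans (toℚᵘ-cong eq) (toℚᵘ-ι y))
  ... | ℚᵘ.*≡* e = trans (sym (ℤₚ.*-identityʳ x)) (trans e (ℤₚ.*-identityʳ y))

  ιℤ-neg : ∀ x → ιℤ (ℤ.- x) ≡ - ιℤ x
  ιℤ-neg x = begin
    ιℤ (ℤ.- x)                        ≡⟨ solve 2 (λ a b → a := (a :+ b) :- b) refl (ιℤ (ℤ.- x)) (ιℤ x) ⟩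
    (ιℤ (ℤ.- x) + ιℤ x) - ιℤ x        ≡⟨ cong (_- ιℤ x) (sym (ιℤ-+ (ℤ.- x) x)) ⟩
    ιℤ (ℤ.- x ℤ.+ x) - ιℤ x           ≡⟨ cong (λ z → ιℤ z - ιℤ x) (ℤₚ.+-inverseˡ x) ⟩
    0ℚ - ιℤ x                         ≡⟨ +-identityˡ _ ⟩
    - ιℤ x                            ∎

  ι-+ : ∀ m n → ι (m ℕ.+ n) ≡ ι m + ι n
  ι-+ m n = ιℤ-+ (+ m) (+ n)

  ι-* : ∀ m n → ι (m ℕ.* n) ≡ ι m * ι n
  ι-* m n = trans (cong ιℤ (ℤₚ.pos-* m n)) (ιℤ-* (+ m) (+ n))

  n/d*d : ∀ n d .{{_ : NonZero d}} → ((+ n) / d) * ι d ≡ ι n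
  n/d*d n d@(suc d-1) = toℚᵘ-injective (ℚᵘ.≃-trans (toℚᵘ-homo-* ((+ n) / d) (ι d))
    (ℚᵘ.≃-trans (ℚᵘ.*-cong (toℚᵘ-fromℚᵘ (ℚᵘ.mkℚᵘ (+ n) d-1)) (toℚᵘ-ι (+ d)))
    (ℚᵘ.≃-trans (ℚᵘ.*≡* (trans (ℤₚ.*-identityʳ _) (cong (+ n ℤ.*_) (cong (+_) (sym (ℕₚ.*-identityʳ d))))))
    (ℚᵘ.≃-sym (toℚᵘ-ι (+ n))))))

  *-cancelʳ-ι : ∀ n .{{_ : NonZero n}} {x y} → x * ι n ≡ y * ι n → x ≡ y
  *-cancelʳ-ι n {x} {y} eq = begin
    x                          ≡⟨ sym (*-identityʳ x) ⟩
    x * 1ℚ                     ≡⟨ cong (x *_) (sym (n/d*d 1 n)) ⟩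
    x * ((+ 1 / n) * ι n)      ≡⟨ solve 3 (λ x i n → x :* (i :* n) := x :* n :* i) refl x (+ 1 / n) (ι n) ⟩
    x * ι n * (+ 1 / n)        ≡⟨ cong (_* (+ 1 / n)) eq ⟩
    y * ι n * (+ 1 / n)        ≡⟨ solve 3 (λ x i n → x :* n :* i := x :* (i :* n)) refl y (+ 1 / n) (ι n) ⟩
    y * ((+ 1 / n) * ι n)      ≡⟨ cong (y *_) (n/d*d 1 n) ⟩
    y * 1ℚ                     ≡⟨ *-identityʳ y ⟩
    y                          ∎

  x*den≡num : ∀ x → x * ι (ℚ.denominatorℕ x) ≡ ιℤ (ℚ.numerator x)
  x*den≡num x@record{} = toℚᵘ-injective (ℚᵘ.≃-trans (toℚᵘ-homo-* x (ι (ℚ.denominatorℕ x)))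
    (ℚᵘ.≃-trans (ℚᵘ.*-cong (ℚᵘ.≃-refl {toℚᵘ x}) (toℚᵘ-ι (+ ℚ.denominatorℕ x)))
    (ℚᵘ.≃-trans (ℚᵘ.*≡* (trans (ℤₚ.*-identityʳ _) (cong (ℚ.numerator x ℤ.*_) (cong (+_) (sym (ℕₚ.*-identityʳ _))))))
    (ℚᵘ.≃-sym (toℚᵘ-ι (ℚ.numerator x))))))

  -- The local ring ℤ_(p) and equality up to its units

  module _ (p : ℕ) (prime : Prime p) where

    instance
      p≢0 : NonZero p
      p≢0 = prime⇒nonZero prime

    1<p : 1 ℕ.< p
    1<p = ℕ.nonTrivial⇒n>1 p {{prime⇒nonTrivial prime}}

    infix 4 p∤_
    record p∤_ (a : ℤ) : Set where
      constructor indivisible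
      field refute : ¬ (p ℕ.∣ ∣ a ∣)

    p∤1 : p∤ (+ 1)
    p∤1 = indivisible λ p∣1 → ℕₚ.<⇒≱ 1<p (ℕ.∣⇒≤ p∣1)

    p∤-* : ∀ {a b} → p∤ a → p∤ b → p∤ a ℤ.* b
    p∤-* {a} {b} (indivisible p∤a) (indivisible p∤b) = indivisible λ p∣ab →
      [ p∤a , p∤b ]′ (euclidsLemma ∣ a ∣ ∣ b ∣ prime (subst (p ℕ.∣_) (ℤₚ.abs-* a b) p∣ab))

    p∤-+p* : ∀ {a} z → p∤ a → p∤ a ℤ.+ + p ℤ.* z
    p∤-+p* {a} z (indivisible p∤a) = indivisible λ p∣ → p∤a (ℤ.∣⇒∣ᵤ {+ p} {a} (ℤ.∣m+n∣n⇒∣m (ℤ.∣ᵤ⇒∣ p∣) (ℤ.∣m⇒∣m*n z ℤ.∣-refl)))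

    p∤-<p : ∀ {n} .{{_ : NonZero n}} → n ℕ.< p → p∤ (+ n)
    p∤-<p n<p = indivisible λ p∣n → ℕₚ.<⇒≱ n<p (ℕ.∣⇒≤ p∣n)

    -- Membership in ℤ_(p). The fraction need not be reduced, so sums and products require no
    -- cancellation.
    record Integral (x : ℚ) : Set where
      constructor integral
      field
        num den   : ℤ
        p∤den     : p∤ den
        den*x≡num : ιℤ den * x ≡ ιℤ num

    -- x ≈ y says that x = u y for a unit u of ℤ₍ₚ₎.
    infix 4 _≈_
    record _≈_ (x y : ℚ) : Set where
      constructor ratio
      field
        num den  : ℤ
        p∤num    : p∤ num
        p∤den    : p∤ den
        cross    : ιℤ den * x ≡ ιℤ num * y

    ι-integral : ∀ n → Integral (ι n)
    ι-integral n = integral (+ n) (+ 1) p∤1 (*-identityˡ (ι n))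

    +-integral : ∀ {x y} → Integral x → Integral y → Integral (x + y)
    +-integral {x} {y} (integral a b p∤b bx≡a) (integral c d p∤d dy≡c) =
      integral (a ℤ.* d ℤ.+ c ℤ.* b) (b ℤ.* d) (p∤-* p∤b p∤d) (begin
        ιℤ (b ℤ.* d) * (x + y)                       ≡⟨ cong (_* (x + y)) (ιℤ-* b d) ⟩
        ιℤ b * ιℤ d * (x + y)                        ≡⟨ solve 4 (λ b d x y → b :* d :* (x :+ y) := b :* x :* d :+ d :* y :* b) refl (ιℤ b) (ιℤ d) x y ⟩
        ιℤ b * x * ιℤ d + ιℤ d * y * ιℤ b            ≡⟨ cong₂ (λ s t → s * ιℤ d + t * ιℤ b) bx≡a dy≡c ⟩
        ιℤ a * ιℤ d + ιℤ c * ιℤ b                    ≡⟨ sym (trans (ιℤ-+ (a ℤ.* d) (c ℤ.* b)) (cong₂ _+_ (ιℤ-* a d) (ιℤ-* c b))) ⟩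
        ιℤ (a ℤ.* d ℤ.+ c ℤ.* b)                     ∎)

    *-integral : ∀ {x y} → Integral x → Integral y → Integral (x * y)
    *-integral {x} {y} (integral a b p∤b bx≡a) (integral c d p∤d dy≡c) =
      integral (a ℤ.* c) (b ℤ.* d) (p∤-* p∤b p∤d) (begin
        ιℤ (b ℤ.* d) * (x * y)     ≡⟨ cong (_* (x * y)) (ιℤ-* b d) ⟩
        ιℤ b * ιℤ d * (x * y)      ≡⟨ solve 4 (λ b d x y → b :* d :* (x :* y) := b :* x :* (d :* y)) refl (ιℤ b) (ιℤ d) x y ⟩
        ιℤ b * x * (ιℤ d * y)      ≡⟨ cong₂ _*_ bx≡a dy≡c ⟩
        ιℤ a * ιℤ c                ≡⟨ sym (ιℤ-* a c) ⟩
        ιℤ (a ℤ.* c)               ∎)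

    neg-integral : ∀ {x} → Integral x → Integral (- x)
    neg-integral {x} (integral a b p∤b bx≡a) = integral (ℤ.- a) b p∤b (begin
      ιℤ b * - x      ≡⟨ sym (neg-distribʳ-* (ιℤ b) x) ⟩
      - (ιℤ b * x)    ≡⟨ cong -_ bx≡a ⟩
      - ιℤ a          ≡⟨ sym (ιℤ-neg a) ⟩
      ιℤ (ℤ.- a)      ∎)

    -‿integral : ∀ {x y} → Integral x → Integral y → Integral (x - y)
    -‿integral ix iy = +-integral ix (neg-integral iy)

    sgn-integral : ∀ n → Integral (sgn n)
    sgn-integral zero    = ι-integral 1
    sgn-integral (suc n) = neg-integral (sgn-integral n)

    ≈-refl : ∀ {x} → x ≈ x
    ≈-refl = ratio (+ 1) (+ 1) p∤1 p∤1 refl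

    ≡⇒≈ : ∀ {x y} → x ≡ y → x ≈ y
    ≡⇒≈ refl = ≈-refl

    ≈-sym : ∀ {x y} → x ≈ y → y ≈ x
    ≈-sym (ratio a b p∤a p∤b e) = ratio b a p∤b p∤a (sym e)

    ≈-trans : ∀ {x y z} → x ≈ y → y ≈ z → x ≈ z
    ≈-trans {x} {y} {z} (ratio a b p∤a p∤b bx≡ay) (ratio c d p∤c p∤d dy≡cz) =
      ratio (a ℤ.* c) (b ℤ.* d) (p∤-* p∤a p∤c) (p∤-* p∤b p∤d) (begin
        ιℤ (b ℤ.* d) * x        ≡⟨ cong (_* x) (ιℤ-* b d) ⟩
        ιℤ b * ιℤ d * x         ≡⟨ solve 3 (λ b d x → b :* d :* x := d :* (b :* x)) refl (ιℤ b) (ιℤ d) x ⟩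
        ιℤ d * (ιℤ b * x)       ≡⟨ cong (ιℤ d *_) bx≡ay ⟩
        ιℤ d * (ιℤ a * y)       ≡⟨ solve 3 (λ d a y → d :* (a :* y) := a :* (d :* y)) refl (ιℤ d) (ιℤ a) y ⟩
        ιℤ a * (ιℤ d * y)       ≡⟨ cong (ιℤ a *_) dy≡cz ⟩
        ιℤ a * (ιℤ c * z)       ≡⟨ sym (*-assoc (ιℤ a) (ιℤ c) z) ⟩
        ιℤ a * ιℤ c * z         ≡⟨ cong (_* z) (sym (ιℤ-* a c)) ⟩
        ιℤ (a ℤ.* c) * z        ∎)

    *-cong-≈ : ∀ {x y u v} → x ≈ y → u ≈ v → x * u ≈ y * v
    *-cong-≈ {x} {y} {u} {v} (ratio a b p∤a p∤b bx≡ay) (ratio c d p∤c p∤d du≡cv) =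
      ratio (a ℤ.* c) (b ℤ.* d) (p∤-* p∤a p∤c) (p∤-* p∤b p∤d) (begin
        ιℤ (b ℤ.* d) * (x * u)       ≡⟨ cong (_* (x * u)) (ιℤ-* b d) ⟩
        ιℤ b * ιℤ d * (x * u)        ≡⟨ inter (ιℤ b) (ιℤ d) x u ⟩
        ιℤ b * x * (ιℤ d * u)        ≡⟨ cong₂ _*_ bx≡ay du≡cv ⟩
        ιℤ a * y * (ιℤ c * v)        ≡⟨ sym (inter (ιℤ a) (ιℤ c) y v) ⟩
        ιℤ a * ιℤ c * (y * v)        ≡⟨ cong (_* (y * v)) (sym (ιℤ-* a c)) ⟩
        ιℤ (a ℤ.* c) * (y * v)       ∎)
      where
      inter : ∀ b d x u → b * d * (x * u) ≡ b * x * (d * u)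
      inter = solve 4 (λ b d x u → b :* d :* (x :* u) := b :* x :* (d :* u)) refl

    *-congˡ-≈ : ∀ x {u v} → u ≈ v → x * u ≈ x * v
    *-congˡ-≈ x = *-cong-≈ (≈-refl {x})

    *-cancelʳ-≈ : ∀ n .{{_ : NonZero n}} {x y} → x * ι n ≈ y * ι n → x ≈ y
    *-cancelʳ-≈ n {x} {y} (ratio a b p∤a p∤b e) = ratio a b p∤a p∤b (*-cancelʳ-ι n (begin
      ιℤ b * x * ι n       ≡⟨ *-assoc (ιℤ b) x (ι n) ⟩
      ιℤ b * (x * ι n)     ≡⟨ e ⟩
      ιℤ a * (y * ι n)     ≡⟨ sym (*-assoc (ιℤ a) y (ι n)) ⟩
      ιℤ a * y * ι n       ∎))

    ≈-integral : ∀ {x y} → x ≈ y → Integral y → Integral x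
    ≈-integral {x} {y} (ratio a b p∤a p∤b bx≡ay) (integral c d p∤d dy≡c) =
      integral (a ℤ.* c) (b ℤ.* d) (p∤-* p∤b p∤d) (begin
        ιℤ (b ℤ.* d) * x      ≡⟨ cong (_* x) (ιℤ-* b d) ⟩
        ιℤ b * ιℤ d * x       ≡⟨ solve 3 (λ b d x → b :* d :* x := d :* (b :* x)) refl (ιℤ b) (ιℤ d) x ⟩
        ιℤ d * (ιℤ b * x)     ≡⟨ cong (ιℤ d *_) bx≡ay ⟩
        ιℤ d * (ιℤ a * y)     ≡⟨ solve 3 (λ d a y → d :* (a :* y) := a :* (d :* y)) refl (ιℤ d) (ιℤ a) y ⟩
        ιℤ a * (ιℤ d * y)     ≡⟨ cong (ιℤ a *_) dy≡c ⟩
        ιℤ a * ιℤ c           ≡⟨ sym (ιℤ-* a c) ⟩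
        ιℤ (a ℤ.* c)          ∎)

    ι-unit : ∀ {n} → ¬ (p ℕ.∣ n) → ι n ≈ 1ℚ
    ι-unit {n} p∤n = ratio (+ n) (+ 1) (indivisible p∤n) p∤1 (*-comm 1ℚ (ι n))

    -- Invertibility is decided modulo p: over a common denominator the numerator changes by a
    -- multiple of p only.
    unit-+p* : ∀ {u y} → u ≈ 1ℚ → Integral y → u + ι p * y ≈ 1ℚ
    unit-+p* {u} {y} (ratio a b p∤a p∤b bu≡a) (integral c d p∤d dy≡c) =
      ratio (a ℤ.* d ℤ.+ + p ℤ.* (b ℤ.* c)) (b ℤ.* d) (p∤-+p* (b ℤ.* c) (p∤-* p∤a p∤d)) (p∤-* p∤b p∤d) (begin
        ιℤ (b ℤ.* d) * (u + ι p * y)                      ≡⟨ cong (_* (u + ι p * y)) (ιℤ-* b d) ⟩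
        ιℤ b * ιℤ d * (u + ι p * y)                       ≡⟨ solve 5 (λ b d u p y → b :* d :* (u :+ p :* y) := b :* u :* d :+ p :* (b :* (d :* y))) refl (ιℤ b) (ιℤ d) u (ι p) y ⟩
        ιℤ b * u * ιℤ d + ι p * (ιℤ b * (ιℤ d * y))       ≡⟨ cong₂ (λ s t → s * ιℤ d + ι p * (ιℤ b * t)) (trans bu≡a (*-identityʳ (ιℤ a))) dy≡c ⟩
        ιℤ a * ιℤ d + ι p * (ιℤ b * ιℤ c)                 ≡⟨ cong₂ (λ s t → s + ι p * t) (sym (ιℤ-* a d)) (sym (ιℤ-* b c)) ⟩
        ιℤ (a ℤ.* d) + ι p * ιℤ (b ℤ.* c)                 ≡⟨ cong (λ t → ιℤ (a ℤ.* d) + t) (sym (ιℤ-* (+ p) (b ℤ.* c))) ⟩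
        ιℤ (a ℤ.* d) + ιℤ (+ p ℤ.* (b ℤ.* c))             ≡⟨ sym (ιℤ-+ (a ℤ.* d) (+ p ℤ.* (b ℤ.* c))) ⟩
        ιℤ (a ℤ.* d ℤ.+ + p ℤ.* (b ℤ.* c))                ≡⟨ sym (*-identityʳ _) ⟩
        ιℤ (a ℤ.* d ℤ.+ + p ℤ.* (b ℤ.* c)) * 1ℚ           ∎)

    neg-≈ : ∀ {x y} → x ≈ y → - x ≈ y
    neg-≈ {x} {y} (ratio a b (indivisible p∤a) p∤b e) = ratio (ℤ.- a) b (indivisible λ p∣ → p∤a (subst (p ℕ.∣_) (ℤₚ.∣-i∣≡∣i∣ a) p∣)) p∤b (begin
      ιℤ b * - x         ≡⟨ sym (neg-distribʳ-* (ιℤ b) x) ⟩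
      - (ιℤ b * x)       ≡⟨ cong -_ e ⟩
      - (ιℤ a * y)       ≡⟨ neg-distribˡ-* (ιℤ a) y ⟩
      - ιℤ a * y         ≡⟨ cong (_* y) (sym (ιℤ-neg a)) ⟩
      ιℤ (ℤ.- a) * y     ∎)

    sgn-unit : ∀ n → sgn n ≈ 1ℚ
    sgn-unit zero    = ≈-refl
    sgn-unit (suc n) = neg-≈ (sgn-unit n)

    -- Clearing denominators would give p (b c) = a d with a and d prime to p. This is the
    -- contradiction that the dominant summand eventually produces.
    p*integral-nonunit : ∀ {x} → Integral x → ¬ (ι p * x ≈ 1ℚ)
    p*integral-nonunit {x} (integral c d p∤d dx≡c) (ratio a b p∤a p∤b e) =
      p∤_.refute (p∤-* p∤a p∤d) (subst (λ z → p ℕ.∣ ∣ z ∣) eq (subst (p ℕ.∣_) (sym (ℤₚ.abs-* (+ p) (b ℤ.* c))) (ℕ.m∣m*n ∣ b ℤ.* c ∣)))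
      where
      eq : + p ℤ.* (b ℤ.* c) ≡ a ℤ.* d
      eq = ιℤ-injective (begin
        ιℤ (+ p ℤ.* (b ℤ.* c))       ≡⟨ trans (ιℤ-* (+ p) (b ℤ.* c)) (cong (ι p *_) (ιℤ-* b c)) ⟩
        ι p * (ιℤ b * ιℤ c)          ≡⟨ cong (λ t → ι p * (ιℤ b * t)) (sym dx≡c) ⟩
        ι p * (ιℤ b * (ιℤ d * x))    ≡⟨ solve 4 (λ p b d x → p :* (b :* (d :* x)) := b :* (p :* x) :* d) refl (ι p) (ιℤ b) (ιℤ d) x ⟩
        ιℤ b * (ι p * x) * ιℤ d      ≡⟨ cong (_* ιℤ d) (trans e (*-identityʳ (ιℤ a))) ⟩
        ιℤ a * ιℤ d                  ≡⟨ sym (ιℤ-* a d) ⟩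
        ιℤ (a ℤ.* d)                 ∎)

    -- Binomial coefficients and the lowest p-adic digit

    binom-suc : ∀ α n → binom α (suc n) * ι (suc n) ≡ binom α n * (α - ι n)
    binom-suc α n = begin
      binom α n * (α - ι n) * (+ 1 / suc n) * ι (suc n)     ≡⟨ *-assoc (binom α n * (α - ι n)) (+ 1 / suc n) (ι (suc n)) ⟩
      binom α n * (α - ι n) * ((+ 1 / suc n) * ι (suc n))   ≡⟨ cong (binom α n * (α - ι n) *_) (n/d*d 1 (suc n)) ⟩
      binom α n * (α - ι n) * 1ℚ                            ≡⟨ *-identityʳ _ ⟩
      binom α n * (α - ι n)                                 ∎

    ι-∸ : ∀ {m n} → n ℕ.≤ m → ι (m ℕ.∸ n) ≡ ι m - ι n
    ι-∸ {m} {n} n≤m = begin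
      ι (m ℕ.∸ n)                  ≡⟨ solve 2 (λ x y → x := x :+ y :- y) refl (ι (m ℕ.∸ n)) (ι n) ⟩
      ι (m ℕ.∸ n) + ι n - ι n      ≡⟨ cong (_- ι n) (sym (ι-+ (m ℕ.∸ n) n)) ⟩
      ι (m ℕ.∸ n ℕ.+ n) - ι n      ≡⟨ cong (λ k → ι k - ι n) (ℕₚ.m∸n+n≡m n≤m) ⟩
      ι m - ι n                    ∎

    ι-∸-unit : ∀ {a b} → b ℕ.< a → a ℕ.< p → ι a - ι b ≈ 1ℚ
    ι-∸-unit {a} {b} b<a a<p = ≈-trans (≡⇒≈ (sym (ι-∸ (ℕₚ.<⇒≤ b<a))))
      (ι-unit (p∤_.refute (p∤-<p {{ℕ.>-nonZero (ℕₚ.m<n⇒0<n∸m b<a)}} (ℕₚ.≤-<-trans (ℕₚ.m∸n≤m a b) a<p))))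

    digit-difference-unit : ∀ {a b} → a ≢ b → a ℕ.< p → b ℕ.< p → ι a - ι b ≈ 1ℚ
    digit-difference-unit {a} {b} a≢b a<p b<p with ℕₚ.<-cmp a b
    ... | tri> _ _ b<a = ι-∸-unit b<a a<p
    ... | tri≈ _ a≡b _ = ⊥-elim (a≢b a≡b)
    ... | tri< a<b _ _ = ≈-trans
      (≡⇒≈ (solve 2 (λ a b → a :- b := :- (b :- a)) refl (ι a) (ι b)))
      (neg-≈ (ι-∸-unit a<b b<p))

    module OneDigit {a : ℕ} (a<p : a ℕ.< p) {β : ℚ} (β-integral : Integral β) where

      α : ℚ
      α = ι a + ι p * β

      factor : ∀ b M → α - ι (b ℕ.+ p ℕ.* M) ≡ ι a - ι b + ι p * (β - ι M)
      factor b M = begin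
        ι a + ι p * β - ι (b ℕ.+ p ℕ.* M)        ≡⟨ cong (λ t → α - t) (trans (ι-+ b (p ℕ.* M)) (cong (_+_ (ι b)) (ι-* p M))) ⟩
        ι a + ι p * β - (ι b + ι p * ι M)        ≡⟨ solve 5 (λ a b p x m → a :+ p :* x :- (b :+ p :* m) := a :- b :+ p :* (x :- m)) refl (ι a) (ι b) (ι p) β (ι M) ⟩
        ι a - ι b + ι p * (β - ι M)              ∎

      factor-unit : ∀ {b} M → a ≢ b → b ℕ.< p → α - ι (b ℕ.+ p ℕ.* M) ≈ 1ℚ
      factor-unit {b} M a≢b b<p = ≈-trans (≡⇒≈ (factor b M))
        (unit-+p* (digit-difference-unit a≢b a<p b<p) (-‿integral β-integral (ι-integral M)))

      factor-p : ∀ M → α - ι (a ℕ.+ p ℕ.* M) ≡ ι p * (β - ι M)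
      factor-p M = trans (factor a M)
        (solve 2 (λ a y → a :- a :+ y := y) refl (ι a) (ι p * (β - ι M)))

      index-unit : ∀ b M → suc b ℕ.< p → ι (suc b ℕ.+ p ℕ.* M) ≈ 1ℚ
      index-unit b M b<p = ≈-trans
        (≡⇒≈ (trans (ι-+ (suc b) (p ℕ.* M)) (cong (_+_ (ι (suc b))) (ι-* p M))))
        (unit-+p* (ι-unit (p∤_.refute (p∤-<p b<p))) (ι-integral M))

      NoCarry Carry : ℕ → ℕ → Set
      NoCarry b M = binom α (b ℕ.+ p ℕ.* M) ≈ binom β M
      Carry   b M = binom α (b ℕ.+ p ℕ.* M) ≈ ι p * ((β - ι M) * binom β M)

      suc-digit : ∀ b M → suc b ℕ.< p → binom α (suc b ℕ.+ p ℕ.* M) ≈ binom α (b ℕ.+ p ℕ.* M) * (α - ι (b ℕ.+ p ℕ.* M))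
      suc-digit b M b<p = ≈-trans
        (≡⇒≈ (sym (*-identityʳ _)))
        (≈-trans (*-congˡ-≈ (binom α (suc N)) (≈-sym (index-unit b M b<p))) (≡⇒≈ (binom-suc α N)))
        where N = b ℕ.+ p ℕ.* M

      wrap-index : ∀ M → p ℕ.* suc M ≡ suc (ℕ.pred p ℕ.+ p ℕ.* M)
      wrap-index M = trans (ℕₚ.*-suc p M) (cong (ℕ._+ p ℕ.* M) (sym (ℕₚ.suc-pred p)))

      -- Dividing by p (M+1) removes the factor p, and (β-M) C(β,M) = (M+1) C(β,M+1). The hypothesis
      -- concerns the product because p may enter at this very step (a = p-1) or have entered
      -- before.
      wrap-step : ∀ M → binom α (ℕ.pred p ℕ.+ p ℕ.* M) * (α - ι (ℕ.pred p ℕ.+ p ℕ.* M)) ≈ ι p * ((β - ι M) * binom β M) →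
                  NoCarry 0 (suc M)
      wrap-step M h = *-cancelʳ-≈ (p ℕ.* suc M) {{ℕₚ.m*n≢0 p (suc M)}}
        (≈-trans (≡⇒≈ left) (≈-trans h (≡⇒≈ right)))
        where
        N = ℕ.pred p ℕ.+ p ℕ.* M
        left : binom α (p ℕ.* suc M) * ι (p ℕ.* suc M) ≡ binom α N * (α - ι N)
        left = trans (cong (λ n → binom α n * ι n) (wrap-index M)) (binom-suc α N)
        right : ι p * ((β - ι M) * binom β M) ≡ binom β (suc M) * ι (p ℕ.* suc M)
        right = begin
          ι p * ((β - ι M) * binom β M)            ≡⟨ cong (ι p *_) (trans (*-comm (β - ι M) (binom β M)) (sym (binom-suc β M))) ⟩
          ι p * (binom β (suc M) * ι (suc M))      ≡⟨ solve 3 (λ p b m → p :* (b :* m) := b :* (p :* m)) refl (ι p) (binom β (suc M)) (ι (suc M)) ⟩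
          binom β (suc M) * (ι p * ι (suc M))      ≡⟨ cong (binom β (suc M) *_) (sym (ι-* p (suc M))) ⟩
          binom β (suc M) * ι (p ℕ.* suc M)        ∎

      carry-step : ∀ M {b} → b ≡ a → NoCarry b M →
                   binom α (b ℕ.+ p ℕ.* M) * (α - ι (b ℕ.+ p ℕ.* M)) ≈ ι p * ((β - ι M) * binom β M)
      carry-step M refl h = ≈-trans (*-cong-≈ h (≡⇒≈ (factor-p M)))
        (≡⇒≈ (solve 3 (λ c p y → c :* (p :* y) := p :* (y :* c)) refl (binom β M) (ι p) (β - ι M)))

      unit-step : ∀ {b} M {y} → a ≢ b → b ℕ.< p → binom α (b ℕ.+ p ℕ.* M) ≈ y →
                  binom α (b ℕ.+ p ℕ.* M) * (α - ι (b ℕ.+ p ℕ.* M)) ≈ y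
      unit-step M {y} a≢b b<p h = ≈-trans (*-cong-≈ h (factor-unit M a≢b b<p)) (≡⇒≈ (*-identityʳ y))

      -- Induction along N = b + pM by (N+1) C(α,N+1) = (α-N) C(α,N). The factor N+1 is a unit
      -- unless p divides it, and α-N is a unit unless N ends in the digit a, where it is p (β-M).
      -- So in each block of p indices a factor p enters just after b = a and leaves at the start of
      -- the next block.
      binom-digit : ∀ M b → b ℕ.< p → (b ℕ.≤ a → NoCarry b M) × (a ℕ.< b → Carry b M)
      binom-digit zero    zero _ =
        (λ _ → ≡⇒≈ (cong (binom α) (ℕₚ.*-zeroʳ p))) , λ ()
      binom-digit (suc M) zero _ with binom-digit M (ℕ.pred p) pred-p<p | ℕ.pred p ℕ.≤? a
        where pred-p<p = ℕₚ.≤-reflexive (ℕₚ.suc-pred p)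
      ... | ≤a⇒ , _ | yes pred-p≤a =
        (λ _ → wrap-step M (carry-step M (ℕₚ.≤-antisym pred-p≤a (ℕₚ.<⇒≤pred a<p)) (≤a⇒ pred-p≤a))) , λ ()
      ... | _ , a<⇒ | no pred-p≰a =
        (λ _ → wrap-step M (unit-step M (ℕₚ.<⇒≢ a<pred) (ℕₚ.≤-reflexive (ℕₚ.suc-pred p)) (a<⇒ a<pred))) , λ ()
        where a<pred = ℕₚ.≰⇒> pred-p≰a
      binom-digit M (suc b) b<p with binom-digit M b (ℕₚ.<-trans (ℕₚ.n<1+n b) b<p)
      ... | ≤a⇒ , a<⇒ = noCarry , carry
        where
        noCarry : suc b ℕ.≤ a → NoCarry (suc b) M
        noCarry b<a = ≈-trans (suc-digit b M b<p)
          (unit-step M (λ a≡b → ℕₚ.<⇒≢ b<a (sym a≡b)) (ℕₚ.<-trans b<a a<p) (≤a⇒ (ℕₚ.<⇒≤ b<a)))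
        carry : a ℕ.< suc b → Carry (suc b) M
        carry (s≤s a≤b) with a ℕ.≟ b
        ... | yes a≡b = ≈-trans (suc-digit b M b<p) (carry-step M (sym a≡b) (≤a⇒ (ℕₚ.≤-reflexive (sym a≡b))))
        ... | no  a≢b = ≈-trans (suc-digit b M b<p)
          (unit-step M a≢b (ℕₚ.<-trans (ℕₚ.n<1+n b) b<p) (a<⇒ (ℕₚ.≤∧≢⇒< a≤b a≢b)))

    -- Digits of elements of ℤ_(p) and integrality of binomial coefficients

    p∤⇒coprime : ∀ {n} → ¬ (p ℕ.∣ n) → Coprime p n
    p∤⇒coprime p∤n (d∣p , d∣n) with prime⇒irreducible prime d∣p
    ... | inj₁ d≡1  = d≡1
    ... | inj₂ refl = ⊥-elim (p∤n d∣n)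

    BezoutRow : ℤ → Set
    BezoutRow d = ∃₂ λ e f → e ℤ.* d ℤ.+ f ℤ.* + p ≡ + 1

    bezout-+ : ∀ {n} → ¬ (p ℕ.∣ n) → BezoutRow (+ n)
    bezout-+ {n} p∤n with coprime-Bézout (p∤⇒coprime p∤n)
    ... | Bézout.+- x y eq = ℤ.- + y , + x , (begin
      ℤ.- + y ℤ.* + n ℤ.+ + x ℤ.* + p                    ≡⟨ cong (λ t → ℤ.- + y ℤ.* + n ℤ.+ t) (trans (sym (ℤₚ.pos-* x p)) (trans (cong +_ (sym eq)) (cong (λ t → + 1 ℤ.+ t) (ℤₚ.pos-* y n)))) ⟩
      ℤ.- + y ℤ.* + n ℤ.+ (+ 1 ℤ.+ + y ℤ.* + n)          ≡⟨ solveℤ 2 (λ y n → ⊝ y ⊗ n ⊕ (conℤ (+ 1) ⊕ y ⊗ n) ⊜ conℤ (+ 1)) refl (+ y) (+ n) ⟩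
      + 1                                                ∎)
    ... | Bézout.-+ x y eq = + y , ℤ.- + x , (begin
      + y ℤ.* + n ℤ.+ ℤ.- + x ℤ.* + p                    ≡⟨ cong (λ t → t ℤ.+ ℤ.- + x ℤ.* + p) (trans (sym (ℤₚ.pos-* y n)) (trans (cong +_ (sym eq)) (cong (λ t → + 1 ℤ.+ t) (ℤₚ.pos-* x p)))) ⟩
      + 1 ℤ.+ + x ℤ.* + p ℤ.+ ℤ.- + x ℤ.* + p            ≡⟨ solveℤ 2 (λ x p → conℤ (+ 1) ⊕ x ⊗ p ⊕ ⊝ x ⊗ p ⊜ conℤ (+ 1)) refl (+ x) (+ p) ⟩
      + 1                                                ∎)

    bezout : ∀ {d} → p∤ d → BezoutRow d
    bezout {+ n} (indivisible p∤n) = bezout-+ p∤n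
    bezout {ℤ.-[1+ n ]} (indivisible p∤n) with bezout-+ p∤n
    ... | e , f , eq = ℤ.- e , f , trans (cong (λ t → t ℤ.+ f ℤ.* + p) (neg*neg e (+ suc n))) eq
      where
      neg*neg : ∀ x y → ℤ.- x ℤ.* ℤ.- y ≡ x ℤ.* y
      neg*neg x y = trans (sym (ℤₚ.neg-distribˡ-* x (ℤ.- y))) (trans (cong ℤ.-_ (sym (ℤₚ.neg-distribʳ-* x y))) (ℤₚ.neg-involutive (x ℤ.* y)))

    record LowDigit (x : ℚ) : Set where
      constructor lowDigit
      field
        digit          : ℕ
        quotient       : ℚ
        digit<p        : digit ℕ.< p
        quot-integral  : Integral quotient
        split          : x ≡ ι digit + ι p * quotient

    -- If e d + f p = 1, then c e is an integer congruent to c/d modulo p, so its residue is the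
    -- digit. The quotient keeps the denominator d.
    low-digit : ∀ {x} → Integral x → LowDigit x
    low-digit {x} (integral c d p∤d dx≡c) with bezout p∤d
    ... | e , f , ed+fp≡1 = lowDigit r y (ℤ.n%ℕd<d (c ℤ.* e) p) (integral (d ℤ.* s ℤ.+ c ℤ.* f) d p∤d dy≡) x≡
      where
      r = (c ℤ.* e) ℤ.%ℕ p
      s = (c ℤ.* e) ℤ./ℕ p
      i = + 1 / p
      y = (x - ι r) * i
      ip≡1 : i * ι p ≡ 1ℚ
      ip≡1 = n/d*d 1 p
      x≡ : x ≡ ι r + ι p * y
      x≡ = begin
        x                                ≡⟨ solve 2 (λ x r → x := r :+ con 1ℚ :* (x :- r)) refl x (ι r) ⟩
        ι r + 1ℚ * (x - ι r)             ≡⟨ cong (λ t → ι r + t * (x - ι r)) (sym ip≡1) ⟩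
        ι r + i * ι p * (x - ι r)        ≡⟨ solve 4 (λ x r i p → r :+ i :* p :* (x :- r) := r :+ p :* ((x :- r) :* i)) refl x (ι r) i (ι p) ⟩
        ι r + ι p * y                    ∎
      c≡ : c ≡ d ℤ.* + r ℤ.+ + p ℤ.* (d ℤ.* s ℤ.+ c ℤ.* f)
      c≡ = begin
        c                                                          ≡⟨ sym (ℤₚ.*-identityʳ c) ⟩
        c ℤ.* + 1                                                  ≡⟨ cong (c ℤ.*_) (sym ed+fp≡1) ⟩
        c ℤ.* (e ℤ.* d ℤ.+ f ℤ.* + p)                              ≡⟨ solveℤ 5 (λ c e d f p → c ⊗ (e ⊗ d ⊕ f ⊗ p) ⊜ (c ⊗ e) ⊗ d ⊕ p ⊗ (c ⊗ f)) refl c e d f (+ p) ⟩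
        (c ℤ.* e) ℤ.* d ℤ.+ + p ℤ.* (c ℤ.* f)                      ≡⟨ cong (λ t → t ℤ.* d ℤ.+ + p ℤ.* (c ℤ.* f)) (ℤ.a≡a%ℕn+[a/ℕn]*n (c ℤ.* e) p) ⟩
        (+ r ℤ.+ s ℤ.* + p) ℤ.* d ℤ.+ + p ℤ.* (c ℤ.* f)            ≡⟨ solveℤ 5 (λ r s p d cf → (r ⊕ s ⊗ p) ⊗ d ⊕ p ⊗ cf ⊜ d ⊗ r ⊕ p ⊗ (d ⊗ s ⊕ cf)) refl (+ r) s (+ p) d (c ℤ.* f) ⟩
        d ℤ.* + r ℤ.+ + p ℤ.* (d ℤ.* s ℤ.+ c ℤ.* f)                ∎
      t = d ℤ.* s ℤ.+ c ℤ.* f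
      dy≡ : ιℤ d * y ≡ ιℤ t
      dy≡ = begin
        ιℤ d * ((x - ι r) * i)                            ≡⟨ solve 4 (λ d x r i → d :* ((x :- r) :* i) := (d :* x :- d :* r) :* i) refl (ιℤ d) x (ι r) i ⟩
        (ιℤ d * x - ιℤ d * ι r) * i                       ≡⟨ cong (λ u → (u - ιℤ d * ι r) * i) (trans dx≡c (cong ιℤ c≡)) ⟩
        (ιℤ (d ℤ.* + r ℤ.+ + p ℤ.* t) - ιℤ d * ι r) * i   ≡⟨ cong (λ u → (u - ιℤ d * ι r) * i) (trans (ιℤ-+ (d ℤ.* + r) (+ p ℤ.* t)) (cong₂ _+_ (ιℤ-* d (+ r)) (ιℤ-* (+ p) t))) ⟩
        (ιℤ d * ι r + ι p * ιℤ t - ιℤ d * ι r) * i        ≡⟨ solve 4 (λ dr p t i → (dr :+ p :* t :- dr) :* i := i :* p :* t) refl (ιℤ d * ι r) (ι p) (ιℤ t) i ⟩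
        i * ι p * ιℤ t                                    ≡⟨ cong (_* ιℤ t) ip≡1 ⟩
        1ℚ * ιℤ t                                         ≡⟨ *-identityˡ (ιℤ t) ⟩
        ιℤ t                                              ∎

    n≡n%p+p*[n/p] : ∀ n → n ≡ n ℕ.% p ℕ.+ p ℕ.* (n ℕ./ p)
    n≡n%p+p*[n/p] n = trans (ℕ.m≡m%n+[m/n]*n n p) (cong (n ℕ.% p ℕ.+_) (ℕₚ.*-comm (n ℕ./ p) p))

    binom-integral-digit : ∀ {a} → a ℕ.< p → ∀ {β} → Integral β → ∀ {b} → b ℕ.< p → ∀ M →
                           Integral (binom β M) → Integral (binom (ι a + ι p * β) (b ℕ.+ p ℕ.* M))
    binom-integral-digit {a} a<p iβ {b} b<p M ih with b ℕ.≤? a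
    ... | yes b≤a = ≈-integral (proj₁ (OneDigit.binom-digit a<p iβ M b b<p) b≤a) ih
    ... | no  b≰a = ≈-integral (proj₂ (OneDigit.binom-digit a<p iβ M b b<p) (ℕₚ.≰⇒> b≰a))
      (*-integral (ι-integral p) (*-integral (-‿integral iβ (ι-integral M)) ih))

    -- Removing one digit from α and from n replaces n by n / p, so the recursion is on n while α
    -- varies. This takes the place of the usual argument by density of ℕ in ℤ_p.
    binom-integral-< : ∀ bound {α} → Integral α → ∀ n → n ℕ.< bound → Integral (binom α n)
    binom-integral-< (suc bound) iα zero _ = ι-integral 1
    binom-integral-< (suc bound) {α} iα (suc n) (s≤s n<bound) =
      subst₂ (λ x k → Integral (binom x k)) (sym split) (sym (n≡n%p+p*[n/p] (suc n)))
        (binom-integral-digit digit<p quot-integral (ℕ.m%n<n (suc n) p) M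
          (binom-integral-< bound quot-integral M M<bound))
      where
      open LowDigit (low-digit iα)
      M = suc n ℕ./ p
      M<bound : M ℕ.< bound
      M<bound = ℕₚ.<-≤-trans (ℕ.m/n<m (suc n) p 1<p) n<bound

    binom-integral : ∀ {α} → Integral α → ∀ n → Integral (binom α n)
    binom-integral iα n = binom-integral-< (suc n) iα n ℕₚ.≤-refl

    -- The L lowest digits of p^L θ - 1 and of p^L - 1 are all p-1, so nothing carries and C(θ-1, 0)
    -- is left.
    binom-all-top-digits : ∀ L {θ} → Integral θ → binom (ι (p ℕ.^ L) * θ - 1ℚ) (ℕ.pred (p ℕ.^ L)) ≈ 1ℚ
    binom-all-top-digits zero iθ = ≈-refl
    binom-all-top-digits (suc L) {θ} iθ = ≈-trans (≡⇒≈ (cong₂ binom α≡ n≡))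
      (≈-trans (proj₁ (OneDigit.binom-digit pred-p<p iβ (ℕ.pred (p ℕ.^ L)) (ℕ.pred p) pred-p<p) ℕₚ.≤-refl)
               (binom-all-top-digits L iθ))
      where
      P = p ℕ.^ L
      β = ι P * θ - 1ℚ
      iβ = -‿integral (*-integral (ι-integral P) iθ) (ι-integral 1)
      pred-p<p = ℕₚ.≤-reflexive (ℕₚ.suc-pred p)
      α≡ : ι (p ℕ.* P) * θ - 1ℚ ≡ ι (ℕ.pred p) + ι p * β
      α≡ = begin
        ι (p ℕ.* P) * θ - 1ℚ                          ≡⟨ cong (λ t → t * θ - 1ℚ) (ι-* p P) ⟩
        ι p * ι P * θ - 1ℚ                            ≡⟨ solve 3 (λ p P t → p :* P :* t :- con 1ℚ := p :- con 1ℚ :+ p :* (P :* t :- con 1ℚ)) refl (ι p) (ι P) θ ⟩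
        ι p - 1ℚ + ι p * β                            ≡⟨ cong (λ t → t + ι p * β) (sym (ι-∸ (ℕₚ.<⇒≤ 1<p))) ⟩
        ι (ℕ.pred p) + ι p * β                        ∎
      n≡ : ℕ.pred (p ℕ.* P) ≡ ℕ.pred p ℕ.+ p ℕ.* ℕ.pred P
      n≡ = cong ℕ.pred (trans (cong (p ℕ.*_) (sym (ℕₚ.suc-pred P {{ℕₚ.m^n≢0 p L}})))
             (OneDigit.wrap-index pred-p<p iβ (ℕ.pred P)))

    -- Kummer's theorem: carries in base p

    carry : Bool → ℕ → ℕ → Bool
    carry false a b = ⌊ a ℕ.<? b ⌋
    carry true  a b = ⌊ a ℕ.≤? b ⌋

    bit : Bool → ℕ
    bit false = 0
    bit true  = 1

    -- When m's low digits exceed α's, a factor p (β - M) survives next to C(β,M),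
    -- where β and M are what remains of α and m after these digits.
    binomWithCarry : Bool → ℚ → ℕ → ℚ
    binomWithCarry false β M = binom β M
    binomWithCarry true  β M = (β - ι M) * binom β M

    binomWithCarry-integral : ∀ c {β} → Integral β → ∀ M → Integral (binomWithCarry c β M)
    binomWithCarry-integral false iβ M = binom-integral iβ M
    binomWithCarry-integral true  iβ M = *-integral (-‿integral iβ (ι-integral M)) (binom-integral iβ M)

    ι[p^1] : ι (p ℕ.^ 1) ≡ ι p
    ι[p^1] = cong ι (ℕₚ.*-identityʳ p)

    -- With a pending factor α-N, a single p arises precisely when a ≤ b: from the binomial
    -- coefficient if a < b, from α-N = p (β-M) if a = b. Either way β-M is what stays pending.
    carry-digit : ∀ c {a b β} → a ℕ.< p → b ℕ.< p → Integral β → ∀ M →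
                  binomWithCarry c (ι a + ι p * β) (b ℕ.+ p ℕ.* M) ≈
                  ι (p ℕ.^ bit (carry c a b)) * binomWithCarry (carry c a b) β M
    carry-digit false {a} {b} {β} a<p b<p iβ M with a ℕ.<? b
    ... | yes a<b = ≈-trans (proj₂ (OneDigit.binom-digit a<p iβ M b b<p) a<b)
                      (≡⇒≈ (cong (_* ((β - ι M) * binom β M)) (sym ι[p^1])))
    ... | no  a≮b = ≈-trans (proj₁ (OneDigit.binom-digit a<p iβ M b b<p) (ℕₚ.≮⇒≥ a≮b))
                      (≡⇒≈ (sym (*-identityˡ _)))
    carry-digit true {a} {b} {β} a<p b<p iβ M with a ℕ.≤? b
    ... | no  a≰b = ≈-trans (*-cong-≈ (OneDigit.factor-unit a<p iβ M (λ a≡b → a≰b (ℕₚ.≤-reflexive a≡b)) b<p)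
                                      (proj₁ (OneDigit.binom-digit a<p iβ M b b<p) (ℕₚ.<⇒≤ (ℕₚ.≰⇒> a≰b))))
                      ≈-refl
    ... | yes a≤b with a ℕ.≟ b
    ...   | no  a≢b = ≈-trans (*-cong-≈ (OneDigit.factor-unit a<p iβ M a≢b b<p)
                                        (proj₂ (OneDigit.binom-digit a<p iβ M b b<p) (ℕₚ.≤∧≢⇒< a≤b a≢b)))
                        (≡⇒≈ (trans (*-identityˡ _) (cong (_* ((β - ι M) * binom β M)) (sym ι[p^1]))))
    ...   | yes a≡b = ≈-trans (*-cong-≈
                         (≡⇒≈ (trans (cong (λ d → ι a + ι p * β - ι (d ℕ.+ p ℕ.* M)) (sym a≡b)) (OneDigit.factor-p a<p iβ M)))
                         (proj₁ (OneDigit.binom-digit a<p iβ M b b<p) (ℕₚ.≤-reflexive (sym a≡b))))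
                        (≡⇒≈ (trans (*-assoc (ι p) (β - ι M) (binom β M)) (cong (_* ((β - ι M) * binom β M)) (sym ι[p^1]))))

    quo dig low : ℕ → ℕ → ℕ
    quo N zero    = N
    quo N (suc l) = quo N l ℕ./ p
    dig N l       = quo N l ℕ.% p
    low N zero    = 0
    low N (suc l) = low N l ℕ.+ p ℕ.^ l ℕ.* dig N l

    dig<p : ∀ N l → dig N l ℕ.< p
    dig<p N l = ℕ.m%n<n (quo N l) p

    digit-shift : ∀ x P a y → x ℕ.+ P ℕ.* a ℕ.+ p ℕ.* P ℕ.* y ≡ x ℕ.+ P ℕ.* (a ℕ.+ p ℕ.* y)
    digit-shift x P a y = begin
      x ℕ.+ P ℕ.* a ℕ.+ p ℕ.* P ℕ.* y            ≡⟨ cong (λ t → x ℕ.+ P ℕ.* a ℕ.+ t) (trans (cong (ℕ._* y) (ℕₚ.*-comm p P)) (ℕₚ.*-assoc P p y)) ⟩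
      x ℕ.+ P ℕ.* a ℕ.+ P ℕ.* (p ℕ.* y)          ≡⟨ ℕₚ.+-assoc x _ _ ⟩
      x ℕ.+ (P ℕ.* a ℕ.+ P ℕ.* (p ℕ.* y))        ≡⟨ cong (x ℕ.+_) (sym (ℕₚ.*-distribˡ-+ P a (p ℕ.* y))) ⟩
      x ℕ.+ P ℕ.* (a ℕ.+ p ℕ.* y)                ∎

    N≡low+p^l*quo : ∀ N l → N ≡ low N l ℕ.+ p ℕ.^ l ℕ.* quo N l
    N≡low+p^l*quo N zero    = sym (ℕₚ.*-identityˡ N)
    N≡low+p^l*quo N (suc l) = begin
      N                                                              ≡⟨ N≡low+p^l*quo N l ⟩
      low N l ℕ.+ p ℕ.^ l ℕ.* quo N l                                ≡⟨ cong (λ t → low N l ℕ.+ p ℕ.^ l ℕ.* t) (n≡n%p+p*[n/p] (quo N l)) ⟩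
      low N l ℕ.+ p ℕ.^ l ℕ.* (dig N l ℕ.+ p ℕ.* quo N (suc l))      ≡⟨ sym (digit-shift (low N l) (p ℕ.^ l) (dig N l) (quo N (suc l))) ⟩
      low N (suc l) ℕ.+ p ℕ.^ suc l ℕ.* quo N (suc l)                ∎

    low-mono-< : ∀ {x y P a b} → x ℕ.< P → a ℕ.< b → x ℕ.+ P ℕ.* a ℕ.< y ℕ.+ P ℕ.* b
    low-mono-< {x} {y} {P} {a} {b} x<P a<b = ℕₚ.<-≤-trans (ℕₚ.+-monoˡ-< (P ℕ.* a) x<P)
      (ℕₚ.≤-trans (ℕₚ.≤-reflexive (sym (ℕₚ.*-suc P a)))
      (ℕₚ.≤-trans (ℕₚ.*-monoʳ-≤ P a<b) (ℕₚ.m≤n+m (P ℕ.* b) y)))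

    low<p^l : ∀ N l → low N l ℕ.< p ℕ.^ l
    low<p^l N zero    = s≤s z≤n
    low<p^l N (suc l) = ℕₚ.<-≤-trans (low-mono-< {y = 0} (low<p^l N l) (dig<p N l)) (ℕₚ.≤-reflexive (ℕₚ.*-comm (p ℕ.^ l) p))

    low-unique : ∀ l {r} z → r ℕ.< p ℕ.^ l → low (r ℕ.+ p ℕ.^ l ℕ.* z) l ≡ r
    low-unique l {r} z r<P = begin
      low N l                                   ≡⟨ sym (ℕ.m<n⇒m%n≡m (low<p^l N l)) ⟩
      low N l ℕ.% P                             ≡⟨ sym (ℕ.[m+kn]%n≡m%n (low N l) (quo N l) P) ⟩
      (low N l ℕ.+ quo N l ℕ.* P) ℕ.% P         ≡⟨ cong (λ t → (low N l ℕ.+ t) ℕ.% P) (ℕₚ.*-comm (quo N l) P) ⟩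
      (low N l ℕ.+ P ℕ.* quo N l) ℕ.% P         ≡⟨ cong (ℕ._% P) (sym (N≡low+p^l*quo N l)) ⟩
      (r ℕ.+ P ℕ.* z) ℕ.% P                     ≡⟨ cong (λ t → (r ℕ.+ t) ℕ.% P) (ℕₚ.*-comm P z) ⟩
      (r ℕ.+ z ℕ.* P) ℕ.% P                     ≡⟨ ℕ.[m+kn]%n≡m%n r z P ⟩
      r ℕ.% P                                   ≡⟨ ℕ.m<n⇒m%n≡m r<P ⟩
      r                                         ∎
      where
      P = p ℕ.^ l
      N = r ℕ.+ P ℕ.* z
      instance
        P≢0 : NonZero P
        P≢0 = ℕₚ.m^n≢0 p l

    module Carries (A m : ℕ) where

      flag : ℕ → Bool
      flag zero    = false
      flag (suc l) = carry (flag l) (dig A l) (dig m l)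

      carries noCarries : ℕ → ℕ
      carries zero      = 0
      carries (suc l)   = bit (flag (suc l)) ℕ.+ carries l
      noCarries zero    = 0
      noCarries (suc l) = bit (not (flag (suc l))) ℕ.+ noCarries l

      noCarries+carries : ∀ l → noCarries l ℕ.+ carries l ≡ l
      noCarries+carries zero = refl
      noCarries+carries (suc l) with flag (suc l)
      ... | false = cong suc (noCarries+carries l)
      ... | true  = trans (ℕₚ.+-suc (noCarries l) (carries l)) (cong suc (noCarries+carries l))

      noCarries-mono : ∀ {l l′} → l ℕ.≤ l′ → noCarries l ℕ.≤ noCarries l′
      noCarries-mono {l} l≤l′ = go (ℕₚ.≤⇒≤′ l≤l′)
        where
        go : ∀ {l′} → l ℕ.≤′ l′ → noCarries l ℕ.≤ noCarries l′
        go ℕ.≤′-refl = ℕₚ.≤-refl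
        go (ℕ.≤′-step l≤) = ℕₚ.≤-trans (go l≤) (ℕₚ.m≤n+m _ _)

      -- The newest digit either decides strictly, or its weak inequality inherits strictness from
      -- the flag below.
      flag⇒low< : ∀ l → flag l ≡ true → low A l ℕ.< low m l
      flag⇒low< (suc l) _ with flag l in eq
      flag⇒low< (suc l) _ | false with dig A l ℕ.<? dig m l
      ... | yes a<b = low-mono-< {y = low m l} (low<p^l A l) a<b
      flag⇒low< (suc l) _ | true with dig A l ℕ.≤? dig m l
      ... | yes a≤b = ℕₚ.+-mono-<-≤ (flag⇒low< l eq) (ℕₚ.*-monoʳ-≤ (p ℕ.^ l) a≤b)

      low≤⇒noFlag : ∀ l → low m l ℕ.≤ low A l → flag l ≡ false
      low≤⇒noFlag l m≤A with flag l in eq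
      ... | false = refl
      ... | true  = ⊥-elim (ℕₚ.<⇒≱ (flag⇒low< l eq) m≤A)

      -- The induction hides digit l in β and M and releases it by `carry-digit`. Leaving β and M
      -- free after l digits serves the summands whose index agrees with m in its low digits only.
      binom-carries : ∀ l {β} → Integral β → ∀ M →
                      binom (ι (low A l) + ι (p ℕ.^ l) * β) (low m l ℕ.+ p ℕ.^ l ℕ.* M) ≈
                      ι (p ℕ.^ carries l) * binomWithCarry (flag l) β M
      binom-carries zero {β} iβ M = ≡⇒≈ (trans
        (cong₂ binom (solve 1 (λ b → con 0ℚ :+ con 1ℚ :* b := b) refl β) (ℕₚ.*-identityˡ M))
        (sym (*-identityˡ (binom β M))))
      binom-carries (suc l) {β} iβ M = ≈-trans (≡⇒≈ (cong₂ binom α≡ (digit-shift (low m l) P b M)))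
        (≈-trans (binom-carries l iβ′ (b ℕ.+ p ℕ.* M))
        (≈-trans (*-congˡ-≈ (ι (p ℕ.^ carries l)) (carry-digit (flag l) (dig<p A l) (dig<p m l) iβ M))
        (≡⇒≈ regroup)))
        where
        P = p ℕ.^ l
        a = dig A l
        b = dig m l
        W = binomWithCarry (flag (suc l)) β M
        c = bit (flag (suc l))
        iβ′ : Integral (ι a + ι p * β)
        iβ′ = +-integral (ι-integral a) (*-integral (ι-integral p) iβ)
        α≡ : ι (low A l ℕ.+ P ℕ.* a) + ι (p ℕ.* P) * β ≡ ι (low A l) + ι P * (ι a + ι p * β)
        α≡ = trans (cong₂ (λ s t → s + t * β) (trans (ι-+ (low A l) (P ℕ.* a)) (cong (_+_ (ι (low A l))) (ι-* P a))) (ι-* p P))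
          (solve 5 (λ x P a p b → x :+ P :* a :+ p :* P :* b := x :+ P :* (a :+ p :* b)) refl (ι (low A l)) (ι P) (ι a) (ι p) β)
        regroup : ι (p ℕ.^ carries l) * (ι (p ℕ.^ c) * W) ≡ ι (p ℕ.^ carries (suc l)) * W
        regroup = begin
          ι (p ℕ.^ carries l) * (ι (p ℕ.^ c) * W)         ≡⟨ solve 3 (λ x y w → x :* (y :* w) := y :* x :* w) refl (ι (p ℕ.^ carries l)) (ι (p ℕ.^ c)) W ⟩
          ι (p ℕ.^ c) * ι (p ℕ.^ carries l) * W           ≡⟨ cong (_* W) (sym (ι-* (p ℕ.^ c) (p ℕ.^ carries l))) ⟩
          ι (p ℕ.^ c ℕ.* p ℕ.^ carries l) * W             ≡⟨ cong (λ t → ι t * W) (sym (ℕₚ.^-distribˡ-+-* p c (carries l))) ⟩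
          ι (p ℕ.^ carries (suc l)) * W                   ∎

    -- Finite sums, removal of the power series factor, bracket coefficients

    Σ<-cong : ∀ N {F G : ℕ → ℚ} → (∀ m → F m ≡ G m) → Σ< N F ≡ Σ< N G
    Σ<-cong zero    F≡G = refl
    Σ<-cong (suc N) F≡G = cong₂ _+_ (Σ<-cong N F≡G) (F≡G N)

    Σ<-zero : ∀ N {F : ℕ → ℚ} → (∀ m → F m ≡ 0ℚ) → Σ< N F ≡ 0ℚ
    Σ<-zero zero    F≡0 = refl
    Σ<-zero (suc N) F≡0 = cong₂ _+_ (Σ<-zero N F≡0) (F≡0 N)

    Σ<-* : ∀ N x (F : ℕ → ℚ) → x * Σ< N F ≡ Σ< N (λ m → x * F m)
    Σ<-* zero    x F = *-zeroʳ x
    Σ<-* (suc N) x F = trans (*-distribˡ-+ x (Σ< N F) (F N)) (cong (_+ x * F N) (Σ<-* N x F))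

    Σ<-truncate : ∀ {N} N′ {F : ℕ → ℚ} → N ℕ.≤ N′ → (∀ m → N ℕ.≤ m → F m ≡ 0ℚ) → Σ< N′ F ≡ Σ< N F
    Σ<-truncate zero z≤n F≡0 = refl
    Σ<-truncate {N} (suc N′) {F} N≤ F≡0 with N ℕ.≟ suc N′
    ... | yes refl = refl
    ... | no  N≢   = trans (cong₂ _+_ (Σ<-truncate N′ N≤N′ F≡0) (F≡0 N′ N≤N′)) (+-identityʳ (Σ< N F))
      where N≤N′ = ℕₚ.≤-pred (ℕₚ.≤∧≢⇒< N≤ N≢)

    Σ<-integral : ∀ N {F : ℕ → ℚ} → (∀ m → m ℕ.< N → Integral (F m)) → Integral (Σ< N F)
    Σ<-integral zero    iF = ι-integral 0
    Σ<-integral (suc N) iF = +-integral (Σ<-integral N (λ m m<N → iF m (ℕₚ.m<n⇒m<1+n m<N))) (iF N ℕₚ.≤-refl)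

    Σ<-isolate : ∀ N {F : ℕ → ℚ} {j} → j ℕ.< N → (∀ m → m ℕ.< N → m ≢ j → Integral (F m)) →
                 Integral (Σ< N F) → Integral (F j)
    Σ<-isolate (suc N) {F} {j} j<sN iF iΣ with j ℕ.≟ N
    ... | yes refl = subst Integral (solve 2 (λ s x → s :+ x :- s := x) refl (Σ< N F) (F N))
      (-‿integral iΣ (Σ<-integral N (λ m m<N → iF m (ℕₚ.m<n⇒m<1+n m<N) (ℕₚ.<⇒≢ m<N))))
    ... | no  j≢N  = Σ<-isolate N (ℕₚ.≤∧≢⇒< (ℕₚ.≤-pred j<sN) j≢N) (λ m m<N → iF m (ℕₚ.m<n⇒m<1+n m<N))
      (subst Integral (solve 2 (λ s x → s :+ x :- x := s) refl (Σ< N F) (F N))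
        (-‿integral iΣ (iF N ℕₚ.≤-refl (λ N≡j → j≢N (sym N≡j)))))

    if-true : ∀ {a} {A : Set a} {b} {x y : A} → T b → (if b then x else y) ≡ x
    if-true {b = true} _ = refl

    if-false : ∀ {a} {A : Set a} {b} {x y : A} → ¬ T b → (if b then x else y) ≡ y
    if-false {b = false} _  = refl
    if-false {b = true}  ¬t = ⊥-elim (¬t _)

    module Convolution (r : ℕ) .{{_ : NonZero r}} (e : ℕ → ℚ) (c : ℕ → ℕ → ℚ) where

      g : ℕ → ℚ
      g n = Σ< (suc n) λ m → if r ℕ.* m ≤ᵇ n then c m (n ℕ.∸ r ℕ.* m) else 0ℚ

      f : ℕ → ℚ
      f n = Σ< (suc n) λ a → Σ< (suc n) λ m →
        if r ℕ.* (a ℕ.+ m) ≤ᵇ n then e a * c m (n ℕ.∸ r ℕ.* (a ℕ.+ m)) else 0ℚ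

      row : ℕ → ℕ → ℚ
      row n a = if r ℕ.* a ≤ᵇ n then e a * g (n ℕ.∸ r ℕ.* a) else 0ℚ

      -- The inner sum runs to n, whereas `g` at n - r a stops earlier; as r ≥ 1, every term in
      -- between vanishes.
      f-row : ∀ n a → Σ< (suc n) (λ m → if r ℕ.* (a ℕ.+ m) ≤ᵇ n then e a * c m (n ℕ.∸ r ℕ.* (a ℕ.+ m)) else 0ℚ) ≡ row n a
      f-row n a with r ℕ.* a ℕ.≤? n
      ... | no  ra≰n = trans
        (Σ<-zero (suc n) λ m → if-false λ t → ra≰n (ℕₚ.≤-trans (ℕₚ.*-monoʳ-≤ r (ℕₚ.m≤m+n a m)) (ℕₚ.≤ᵇ⇒≤ _ _ t)))
        (sym (if-false λ t → ra≰n (ℕₚ.≤ᵇ⇒≤ _ _ t)))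
      ... | yes ra≤n = begin
        Σ< (suc n) (λ m → if r ℕ.* (a ℕ.+ m) ≤ᵇ n then e a * c m (n ℕ.∸ r ℕ.* (a ℕ.+ m)) else 0ℚ)  ≡⟨ Σ<-cong (suc n) shift ⟩
        Σ< (suc n) (λ m → e a * term m)          ≡⟨ sym (Σ<-* (suc n) (e a) term) ⟩
        e a * Σ< (suc n) term                    ≡⟨ cong (e a *_) (Σ<-truncate (suc n) (s≤s (ℕₚ.m∸n≤m n (r ℕ.* a))) beyond) ⟩
        e a * g n′                               ≡⟨ sym (if-true (ℕₚ.≤⇒≤ᵇ ra≤n)) ⟩
        row n a                                  ∎
        where
        n′ = n ℕ.∸ r ℕ.* a
        term : ℕ → ℚ
        term m = if r ℕ.* m ≤ᵇ n′ then c m (n′ ℕ.∸ r ℕ.* m) else 0ℚ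
        beyond : ∀ m → suc n′ ℕ.≤ m → term m ≡ 0ℚ
        beyond m n′<m = if-false λ t → ℕₚ.<⇒≱ n′<m (ℕₚ.≤-trans (ℕₚ.m≤n*m m r) (ℕₚ.≤ᵇ⇒≤ _ _ t))
        shift : ∀ m → (if r ℕ.* (a ℕ.+ m) ≤ᵇ n then e a * c m (n ℕ.∸ r ℕ.* (a ℕ.+ m)) else 0ℚ) ≡ e a * term m
        shift m with r ℕ.* m ℕ.≤? n′
        ... | yes rm≤n′ = trans (if-true (ℕₚ.≤⇒≤ᵇ bound))
              (cong (e a *_) (trans (cong (c m) (trans (cong (n ℕ.∸_) (ℕₚ.*-distribˡ-+ r a m)) (sym (ℕₚ.∸-+-assoc n (r ℕ.* a) (r ℕ.* m)))))
                                    (sym (if-true (ℕₚ.≤⇒≤ᵇ rm≤n′)))))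
          where
          bound : r ℕ.* (a ℕ.+ m) ℕ.≤ n
          bound = ℕₚ.≤-trans (ℕₚ.≤-reflexive (ℕₚ.*-distribˡ-+ r a m))
            (ℕₚ.≤-trans (ℕₚ.+-monoʳ-≤ (r ℕ.* a) rm≤n′) (ℕₚ.≤-reflexive (ℕₚ.m+[n∸m]≡n ra≤n)))
        ... | no  rm≰n′ = trans (if-false λ t → rm≰n′ (bound (ℕₚ.≤ᵇ⇒≤ _ _ t)))
              (sym (trans (cong (e a *_) (if-false {b = r ℕ.* m ≤ᵇ n′} λ t → rm≰n′ (ℕₚ.≤ᵇ⇒≤ _ _ t))) (*-zeroʳ (e a))))
          where
          bound : r ℕ.* (a ℕ.+ m) ℕ.≤ n → r ℕ.* m ℕ.≤ n′
          bound h = subst (ℕ._≤ n′) (trans (cong (ℕ._∸ r ℕ.* a) (ℕₚ.*-distribˡ-+ r a m)) (ℕₚ.m+n∸m≡n (r ℕ.* a) (r ℕ.* m)))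
            (ℕₚ.∸-monoˡ-≤ (r ℕ.* a) h)

      f≡Σrow : ∀ n → f n ≡ Σ< (suc n) (row n)
      f≡Σrow n = Σ<-cong (suc n) (f-row n)

      row-zero : e 0 ≡ 1ℚ → ∀ n → row n 0 ≡ g n
      row-zero e₀≡1 n = trans (if-true (subst (λ t → T (t ≤ᵇ n)) (sym (ℕₚ.*-zeroʳ r)) _))
        (trans (cong₂ (λ x t → x * g (n ℕ.∸ t)) e₀≡1 (ℕₚ.*-zeroʳ r)) (*-identityˡ (g n)))

      -- As e 0 = 1, g n is f n minus terms involving only smaller indices.
      deconvolve : ∀ {s} → e 0 ≡ 1ℚ → (∀ a → Integral (e a)) → ∀ N →
                   (∀ n → n ℕ.< N → Integral (s * f n)) → ∀ n → n ℕ.< N → Integral (s * g n)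
      deconvolve {s} e₀≡1 ie (suc N) sf n n<sN with n ℕ.≟ N
      ... | no n≢N = deconvolve {s} e₀≡1 ie N (λ n n<N → sf n (ℕₚ.m<n⇒m<1+n n<N)) n (ℕₚ.≤∧≢⇒< (ℕₚ.≤-pred n<sN) n≢N)
      ... | yes refl = subst (λ t → Integral (s * t)) (row-zero e₀≡1 n)
        (Σ<-isolate (suc n) {λ a → s * row n a} (s≤s z≤n) others
          (subst Integral (trans (cong (s *_) (f≡Σrow n)) (Σ<-* (suc n) s (row n))) (sf n ℕₚ.≤-refl)))
        where
        others : ∀ a → a ℕ.< suc n → a ≢ 0 → Integral (s * row n a)
        others a _ a≢0 with r ℕ.* a ℕ.≤? n
        ... | no  ra≰n = subst Integral
          (sym (trans (cong (s *_) (if-false λ t → ra≰n (ℕₚ.≤ᵇ⇒≤ _ _ t))) (*-zeroʳ s))) (ι-integral 0)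
        ... | yes ra≤n = subst Integral
          (trans (solve 3 (λ e s g → e :* (s :* g) := s :* (e :* g)) refl (e a) s (g n′)) (cong (s *_) (sym (if-true (ℕₚ.≤⇒≤ᵇ ra≤n)))))
          (*-integral (ie a) (deconvolve {s} e₀≡1 ie n (λ n n<N → sf n (ℕₚ.m<n⇒m<1+n n<N)) n′ n′<n))
          where
          n′ = n ℕ.∸ r ℕ.* a
          n′<n : n′ ℕ.< n
          n′<n = ℕₚ.∸-monoʳ-< {n} {r ℕ.* a} {0} (ℕₚ.≤-trans (ℕₚ.n≢0⇒n>0 a≢0) (ℕₚ.m≤n*m a r)) ra≤n

    -- From C(x,j+1)/x = C(x-1,j)/(j+1). For p-integral x, only the index j+1 can thus put p in a
    -- denominator.
    bracketCoeff-binom : ∀ x j → bracketCoeff x j * ι (suc j) ≡ sgn (suc j) * binom (x - 1ℚ) j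
    bracketCoeff-binom x j = begin
      sgn (suc j) * fallFrom1 x j * (invFact j * (+ 1 / suc j)) * ι (suc j)      ≡⟨ solve 5 (λ s f v i n → s :* f :* (v :* i) :* n := s :* (f :* v) :* (i :* n)) refl (sgn (suc j)) (fallFrom1 x j) (invFact j) (+ 1 / suc j) (ι (suc j)) ⟩
      sgn (suc j) * (fallFrom1 x j * invFact j) * ((+ 1 / suc j) * ι (suc j))    ≡⟨ cong₂ (λ s t → sgn (suc j) * s * t) (fall-binom j) (n/d*d 1 (suc j)) ⟩
      sgn (suc j) * binom (x - 1ℚ) j * 1ℚ                                        ≡⟨ *-identityʳ _ ⟩
      sgn (suc j) * binom (x - 1ℚ) j                                             ∎
      where
      fall-binom : ∀ j → fallFrom1 x j * invFact j ≡ binom (x - 1ℚ) j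
      fall-binom zero    = refl
      fall-binom (suc j) = begin
        fallFrom1 x j * (x - ι (suc j)) * (invFact j * (+ 1 / suc j))        ≡⟨ cong (λ t → fallFrom1 x j * (x - t) * (invFact j * (+ 1 / suc j))) (ι-+ 1 j) ⟩
        fallFrom1 x j * (x - (1ℚ + ι j)) * (invFact j * (+ 1 / suc j))       ≡⟨ solve 5 (λ f x j v i → f :* (x :- (con 1ℚ :+ j)) :* (v :* i) := f :* v :* (x :- con 1ℚ :- j) :* i) refl (fallFrom1 x j) x (ι j) (invFact j) (+ 1 / suc j) ⟩
        fallFrom1 x j * invFact j * (x - 1ℚ - ι j) * (+ 1 / suc j)           ≡⟨ cong (λ t → t * (x - 1ℚ - ι j) * (+ 1 / suc j)) (fall-binom j) ⟩
        binom (x - 1ℚ) (suc j)                                               ∎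

    -- Powers of p and the weight of a single summand

    ι-^-+ : ∀ m n → ι (p ℕ.^ (m ℕ.+ n)) ≡ ι (p ℕ.^ m) * ι (p ℕ.^ n)
    ι-^-+ m n = trans (cong ι (ℕₚ.^-distribˡ-+-* p m n)) (ι-* (p ℕ.^ m) (p ℕ.^ n))

    p-part-< : ∀ bound n .{{_ : NonZero n}} → n ℕ.< bound → ∃₂ λ l u → n ≡ p ℕ.^ l ℕ.* u × ¬ (p ℕ.∣ u)
    p-part-< (suc bound) n (s≤s n≤bound) with p ℕ.∣? n
    ... | no  p∤n = 0 , n , sym (ℕₚ.*-identityˡ n) , p∤n
    ... | yes (ℕ.divides zero refl) = ⊥-elim (ℕ.≢-nonZero⁻¹ 0 refl)
    ... | yes (ℕ.divides m@(suc _) refl) with p-part-< bound m (ℕₚ.<-≤-trans (ℕₚ.m<m*n m p 1<p) n≤bound)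
    ...   | l , u , m≡ , p∤u = suc l , u , trans (ℕₚ.*-comm m p) (trans (cong (p ℕ.*_) m≡) (sym (ℕₚ.*-assoc p (p ℕ.^ l) u))) , p∤u

    p-part : ∀ n .{{_ : NonZero n}} → ∃₂ λ l u → n ≡ p ℕ.^ l ℕ.* u × ¬ (p ℕ.∣ u)
    p-part n = p-part-< (suc n) n ℕₚ.≤-refl

    p^∣-cancel : ∀ {r} → ¬ (p ℕ.∣ r) → ∀ l {x} → p ℕ.^ l ℕ.∣ r ℕ.* x → p ℕ.^ l ℕ.∣ x
    p^∣-cancel p∤r zero    _ = ℕ.1∣ _
    p^∣-cancel {r} p∤r (suc l) {x} h with euclidsLemma r x prime (ℕ.∣-trans (ℕ.m∣m*n (p ℕ.^ l)) h)
    ... | inj₁ p∣r = ⊥-elim (p∤r p∣r)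
    ... | inj₂ (ℕ.divides y refl) = subst (p ℕ.* p ℕ.^ l ℕ.∣_) (ℕₚ.*-comm p y)
      (ℕ.*-monoʳ-∣ p (p^∣-cancel p∤r l (ℕ.*-cancelˡ-∣ p (subst (p ℕ.* p ℕ.^ l ℕ.∣_) r*yp≡ h))))
      where
      r*yp≡ : r ℕ.* (y ℕ.* p) ≡ p ℕ.* (r ℕ.* y)
      r*yp≡ = trans (sym (ℕₚ.*-assoc r y p)) (ℕₚ.*-comm (r ℕ.* y) p)

    low-+-multiple : ∀ n l z → low (n ℕ.+ p ℕ.^ l ℕ.* z) l ≡ low n l
    low-+-multiple n l z = trans
      (cong (λ t → low t l) (trans (cong (ℕ._+ p ℕ.^ l ℕ.* z) (N≡low+p^l*quo n l))
        (trans (ℕₚ.+-assoc (low n l) _ _) (cong (low n l ℕ.+_) (sym (ℕₚ.*-distribˡ-+ (p ℕ.^ l) (quo n l) z))))))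
      (low-unique l (quo n l ℕ.+ z) (low<p^l n l))

    low-cong : ∀ l {m n} → m ℕ.≤ n → p ℕ.^ l ℕ.∣ n ℕ.∸ m → low n l ≡ low m l
    low-cong l {m} {n} m≤n (ℕ.divides z n∸m≡) = trans
      (cong (λ t → low t l) (trans (sym (ℕₚ.m+[n∸m]≡n m≤n)) (cong (m ℕ.+_) (trans n∸m≡ (ℕₚ.*-comm z (p ℕ.^ l))))))
      (low-+-multiple m l z)

    -- If the p-part of the denominator is p^l, then l > B is excluded, so p^B clears it and a
    -- denominator prime to p remains.
    p^B∤den⇒integral : ∀ B x → ¬ (p ℕ.^ B ℕ.∣ ℚ.denominatorℕ x) → Integral (ι (p ℕ.^ B) * x)
    p^B∤den⇒integral B x@record{} p^B∤den with p-part (ℚ.denominatorℕ x)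
    ... | l , u , den≡ , p∤u = integral (+ (p ℕ.^ w) ℤ.* ℚ.numerator x) (+ u) (indivisible p∤u) (begin
      ι u * (ι (p ℕ.^ B) * x)                       ≡⟨ cong (λ e → ι u * (ι (p ℕ.^ e) * x)) (sym (ℕₚ.m∸n+n≡m l≤B)) ⟩
      ι u * (ι (p ℕ.^ (w ℕ.+ l)) * x)               ≡⟨ cong (λ t → ι u * (t * x)) (ι-^-+ w l) ⟩
      ι u * (ι (p ℕ.^ w) * ι (p ℕ.^ l) * x)         ≡⟨ solve 4 (λ u w l x → u :* (w :* l :* x) := w :* (x :* (l :* u))) refl (ι u) (ι (p ℕ.^ w)) (ι (p ℕ.^ l)) x ⟩
      ι (p ℕ.^ w) * (x * (ι (p ℕ.^ l) * ι u))       ≡⟨ cong (λ t → ι (p ℕ.^ w) * (x * t)) (trans (sym (ι-* (p ℕ.^ l) u)) (cong ι (sym den≡))) ⟩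
      ι (p ℕ.^ w) * (x * ι (ℚ.denominatorℕ x))      ≡⟨ cong (ι (p ℕ.^ w) *_) (x*den≡num x) ⟩
      ι (p ℕ.^ w) * ιℤ (ℚ.numerator x)              ≡⟨ sym (ιℤ-* (+ (p ℕ.^ w)) (ℚ.numerator x)) ⟩
      ιℤ (+ (p ℕ.^ w) ℤ.* ℚ.numerator x)            ∎)
      where
      w = B ℕ.∸ l
      l≤B : l ℕ.≤ B
      l≤B with l ℕ.≤? B
      ... | yes l≤B = l≤B
      ... | no  l≰B = ⊥-elim (p^B∤den (subst (p ℕ.^ B ℕ.∣_) (sym den≡) (ℕ.∣-trans
        (subst (λ e → p ℕ.^ B ℕ.∣ p ℕ.^ e) (ℕₚ.m+[n∸m]≡n (ℕₚ.<⇒≤ (ℕₚ.≰⇒> l≰B)))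
          (subst (p ℕ.^ B ℕ.∣_) (sym (ℕₚ.^-distribˡ-+-* p B (l ℕ.∸ B))) (ℕ.m∣m*n _)))
        (ℕ.m∣m*n u))))

    -- Here p^E is the scaling, κ counts carries in C(α,m), and l is the valuation of the index N by
    -- which the bracket divides; comparing l with E + κ settles integrality.
    scaled-term : ∀ E κ l s br s′ b {C W} N → ι N ≈ ι (p ℕ.^ l) → br * ι N ≡ s′ * b → C ≈ ι (p ℕ.^ κ) * W →
                  ι (p ℕ.^ E) * (s * C * br) * ι (p ℕ.^ l) ≈ ι (p ℕ.^ (E ℕ.+ κ)) * (s * W * (s′ * b))
    scaled-term E κ l s br s′ b {C} {W} N N≈ brN≡ C≈ = ≈-trans (*-congˡ-≈ (e * (s * C * br)) (≈-sym N≈))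
      (≈-trans (≡⇒≈ (trans
        (solve 5 (λ e s C br n → e :* (s :* C :* br) :* n := C :* (e :* s :* (br :* n))) refl e s C br (ι N))
        (cong (λ t → C * (e * s * t)) brN≡)))
      (≈-trans (*-cong-≈ C≈ (≈-refl {e * s * (s′ * b)}))
      (≡⇒≈ (trans
        (solve 5 (λ k W e s t → k :* W :* (e :* s :* t) := e :* k :* (s :* W :* t)) refl (ι (p ℕ.^ κ)) W e s (s′ * b))
        (cong (_* (s * W * (s′ * b))) (sym (ι-^-+ E κ)))))))
      where e = ι (p ℕ.^ E)

    integral-term : ∀ E κ l {X Y} → l ℕ.≤ E ℕ.+ κ → X * ι (p ℕ.^ l) ≈ ι (p ℕ.^ (E ℕ.+ κ)) * Y → Integral Y → Integral X
    integral-term E κ l {X} {Y} l≤ X≈ iY = ≈-integral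
      (*-cancelʳ-≈ (p ℕ.^ l) {{ℕₚ.m^n≢0 p l}} (≈-trans X≈ (≡⇒≈ (begin
        ι (p ℕ.^ (E ℕ.+ κ)) * Y                  ≡⟨ cong (λ t → ι (p ℕ.^ t) * Y) (sym (ℕₚ.m∸n+n≡m l≤)) ⟩
        ι (p ℕ.^ (w ℕ.+ l)) * Y                  ≡⟨ cong (_* Y) (ι-^-+ w l) ⟩
        ι (p ℕ.^ w) * ι (p ℕ.^ l) * Y            ≡⟨ solve 3 (λ w l y → w :* l :* y := w :* y :* l) refl (ι (p ℕ.^ w)) (ι (p ℕ.^ l)) Y ⟩
        ι (p ℕ.^ w) * Y * ι (p ℕ.^ l)            ∎))))
      (*-integral (ι-integral (p ℕ.^ w)) iY)
      where w = E ℕ.+ κ ℕ.∸ l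

    unit-over-p : ∀ e {X Y} → X * ι (p ℕ.^ suc e) ≈ ι (p ℕ.^ e) * Y → Y ≈ 1ℚ → ι p * X ≈ 1ℚ
    unit-over-p e {X} {Y} X≈ Y≈1 = *-cancelʳ-≈ (p ℕ.^ e) {{ℕₚ.m^n≢0 p e}}
      (≈-trans (≡⇒≈ (trans (solve 3 (λ p X e → p :* X :* e := X :* (p :* e)) refl (ι p) X (ι (p ℕ.^ e))) (cong (X *_) (sym (ι-* p (p ℕ.^ e))))))
      (≈-trans X≈ (≈-trans (*-congˡ-≈ (ι (p ℕ.^ e)) Y≈1) (≡⇒≈ (*-comm (ι (p ℕ.^ e)) 1ℚ)))))

    -- The dominant summand at a carry-free level

    module Core (f r c : ℕ) (p^f≡ : p ℕ.^ suc f ≡ suc r) .{{_ : NonZero r}} (seed : Seed r c)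
                (k d : ℕ) .{{_ : NonZero d}} (α-eq : ι (suc (suc r)) * frac k d ≡ ι c) where

      open Tower seed
      open Seed seed using (x; y; exponent)

      α : ℚ
      α = frac k d

      q+1 : ℕ
      q+1 = suc (suc r)

      p∣q : p ℕ.∣ suc r
      p∣q = subst (p ℕ.∣_) p^f≡ (ℕ.m∣m*n (p ℕ.^ f))

      p∤r : ¬ (p ℕ.∣ r)
      p∤r p∣r = p∤_.refute p∤1 (ℕ.∣m+n∣m⇒∣n (subst (p ℕ.∣_) (ℕₚ.+-comm 1 r) p∣q) p∣r)

      p∤q+1 : ¬ (p ℕ.∣ q+1)
      p∤q+1 h = p∤_.refute p∤1 (ℕ.∣m+n∣m⇒∣n (subst (p ℕ.∣_) (ℕₚ.+-comm 1 (suc r)) h) p∣q)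

      i : ℚ
      i = + 1 / q+1

      i*q+1 : i * ι q+1 ≡ 1ℚ
      i*q+1 = n/d*d 1 q+1

      α-integral : Integral α
      α-integral = integral (+ c) (+ q+1) (indivisible p∤q+1) α-eq

      i-integral : Integral i
      i-integral = integral (+ 1) (+ q+1) (indivisible p∤q+1) (trans (*-comm (ι q+1) i) i*q+1)

      ℓ : ℕ → ℕ
      ℓ zero    = suc f ℕ.* exponent
      ℓ (suc t) = suc f ℕ.* 2 ℕ.+ ℓ t

      p^f*≡ : ∀ e → p ℕ.^ (suc f ℕ.* e) ≡ suc r ℕ.^ e
      p^f*≡ e = trans (sym (ℕₚ.^-*-assoc p (suc f) e)) (cong (ℕ._^ e) p^f≡)

      p^ℓ≡Q : ∀ t → p ℕ.^ ℓ t ≡ Q t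
      p^ℓ≡Q zero    = p^f*≡ exponent
      p^ℓ≡Q (suc t) = trans (ℕₚ.^-distribˡ-+-* p (suc f ℕ.* 2) (ℓ t)) (cong₂ ℕ._*_ (p^f*≡ 2) (p^ℓ≡Q t))

      module Level (B : ℕ) where

        -- Level B+1 supplies at least B+1 carry-free positions up to L. Position L itself is spent
        -- on making the dominance strict, so `E` counts those up to `L′` and is still at least B.
        t L′ L P : ℕ
        t  = suc B
        L′ = suc (f ℕ.* 2 ℕ.+ ℓ B)
        L  = suc L′
        P  = p ℕ.^ L

        P≡Q : P ≡ Q t
        P≡Q = p^ℓ≡Q t

        instance
          P≢0 : NonZero P
          P≢0 = ℕₚ.m^n≢0 p L

        open Carries (A t) (m t)

        low-level : ∀ (D : ℕ → ℕ) → (∀ s → D s ℕ.< Q s) → (∀ s d → ∃ λ z → D (d ℕ.+ s) ≡ D s ℕ.+ Q s ℕ.* z) →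
                    ∀ s → s ℕ.≤ t → low (D t) (ℓ s) ≡ D s
        low-level D D<Q D-congruent s s≤t with D-congruent s (t ℕ.∸ s)
        ... | z , D≡ = trans
          (cong (λ n → low n (ℓ s)) (trans (cong D (sym (ℕₚ.m∸n+n≡m s≤t))) (trans D≡ (cong (λ u → D s ℕ.+ u ℕ.* z) (sym (p^ℓ≡Q s))))))
          (low-unique (ℓ s) z (subst (D s ℕ.<_) (sym (p^ℓ≡Q s)) (D<Q s)))

        low-A : ∀ s → s ℕ.≤ t → low (A t) (ℓ s) ≡ A s
        low-A = low-level A A<Q A-congruent

        m<Q : ∀ s → m s ℕ.< Q s
        m<Q s = ℕₚ.≤-<-trans (m≤A s) (A<Q s)

        low-m : ∀ s → s ℕ.≤ t → low (m t) (ℓ s) ≡ m s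
        low-m = low-level m m<Q m-congruent

        noFlag : ∀ s → s ℕ.≤ t → flag (ℓ s) ≡ false
        noFlag s s≤t = low≤⇒noFlag (ℓ s) (subst₂ ℕ._≤_ (sym (low-m s s≤t)) (sym (low-A s s≤t)) (m≤A s))

        noCarries-step : ∀ l → flag (suc l) ≡ false → noCarries (suc l) ≡ suc (noCarries l)
        noCarries-step l eq rewrite eq = refl

        noCarries-ℓ : ∀ s → s ℕ.≤ t → s ℕ.≤ noCarries (ℓ s)
        noCarries-ℓ zero    _   = z≤n
        noCarries-ℓ (suc s) s<t = subst (suc s ℕ.≤_) (sym (noCarries-step l (noFlag (suc s) s<t)))
          (s≤s (ℕₚ.≤-trans (noCarries-ℓ s (ℕₚ.<⇒≤ s<t)) (noCarries-mono (ℕₚ.m≤n+m (ℓ s) (suc (f ℕ.* 2))))))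
          where
          l : ℕ
          l = suc (f ℕ.* 2) ℕ.+ ℓ s

        E : ℕ
        E = noCarries L′

        B≤E : B ℕ.≤ E
        B≤E = ℕₚ.≤-pred (subst (t ℕ.≤_) (noCarries-step L′ (noFlag t ℕₚ.≤-refl)) (noCarries-ℓ t ℕₚ.≤-refl))

        -- The valuation carries - L of the dominant summand is therefore -(E+1).
        L≡ : L ≡ suc (E ℕ.+ carries L)
        L≡ = trans (sym (noCarries+carries L)) (cong (ℕ._+ carries L) (noCarries-step L′ (noFlag t ℕₚ.≤-refl)))

        -- The tail of α beyond its L lowest digits: (q+1) A = c + x P divided by q+1 reads α = A -
        -- P x/(q+1).
        θ : ℚ
        θ = - (ι x * i)

        θ-integral : Integral θ
        θ-integral = neg-integral (*-integral (ι-integral x) i-integral)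

        α≡A+Pθ : α ≡ ι (A t) + ι P * θ
        α≡A+Pθ = *-cancelʳ-ι q+1 (begin
          α * ι q+1                                                    ≡⟨ trans (*-comm α (ι q+1)) α-eq ⟩
          ι c                                                          ≡⟨ solve 2 (λ c z → c := c :+ z :- z) refl (ι c) (ι x * ι P) ⟩
          ι c + ι x * ι P - ι x * ι P                                  ≡⟨ cong (_- ι x * ι P) (sym A-eqℚ) ⟩
          ι q+1 * ι (A t) - ι x * ι P                                  ≡⟨ solve 4 (λ n a x P → n :* a :- x :* P := a :* n :- P :* x :* con 1ℚ) refl (ι q+1) (ι (A t)) (ι x) (ι P) ⟩
          ι (A t) * ι q+1 - ι P * ι x * 1ℚ                             ≡⟨ cong (λ u → ι (A t) * ι q+1 - ι P * ι x * u) (sym i*q+1) ⟩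
          ι (A t) * ι q+1 - ι P * ι x * (i * ι q+1)                    ≡⟨ solve 5 (λ a n P x i → a :* n :- P :* x :* (i :* n) := (a :+ P :* :- (x :* i)) :* n) refl (ι (A t)) (ι q+1) (ι P) (ι x) i ⟩
          (ι (A t) + ι P * θ) * ι q+1                                  ∎)
          where
          A-eqℚ : ι q+1 * ι (A t) ≡ ι c + ι x * ι P
          A-eqℚ = trans (sym (ι-* q+1 (A t))) (trans (cong ι (trans (A-eq t) (cong (λ u → c ℕ.+ x ℕ.* u) (sym P≡Q))))
            (trans (ι-+ c (x ℕ.* P)) (cong (_+_ (ι c)) (ι-* x P))))

        θ-at : ℕ → ℚ
        θ-at l = ι (quo (A t) l) + ι (p ℕ.^ (L ℕ.∸ l)) * θ

        θ-at-integral : ∀ l → Integral (θ-at l)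
        θ-at-integral l = +-integral (ι-integral (quo (A t) l)) (*-integral (ι-integral (p ℕ.^ (L ℕ.∸ l))) θ-integral)

        α≡low+ : ∀ l → l ℕ.≤ L → α ≡ ι (low (A t) l) + ι (p ℕ.^ l) * θ-at l
        α≡low+ l l≤L = begin
          α                                                                       ≡⟨ α≡A+Pθ ⟩
          ι (A t) + ι P * θ                                                       ≡⟨ cong₂ (λ u v → u + v * θ) A≡ P≡ ⟩
          ι (low (A t) l) + ι (p ℕ.^ l) * ι (quo (A t) l) + ι (p ℕ.^ l) * ι (p ℕ.^ (L ℕ.∸ l)) * θ
            ≡⟨ solve 5 (λ a Q z w θ → a :+ Q :* z :+ Q :* w :* θ := a :+ Q :* (z :+ w :* θ)) refl (ι (low (A t) l)) (ι (p ℕ.^ l)) (ι (quo (A t) l)) (ι (p ℕ.^ (L ℕ.∸ l))) θ ⟩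
          ι (low (A t) l) + ι (p ℕ.^ l) * θ-at l                                  ∎
          where
          A≡ : ι (A t) ≡ ι (low (A t) l) + ι (p ℕ.^ l) * ι (quo (A t) l)
          A≡ = trans (cong ι (N≡low+p^l*quo (A t) l)) (trans (ι-+ (low (A t) l) _) (cong (_+_ (ι (low (A t) l))) (ι-* (p ℕ.^ l) (quo (A t) l))))
          P≡ : ι P ≡ ι (p ℕ.^ l) * ι (p ℕ.^ (L ℕ.∸ l))
          P≡ = trans (cong (λ e → ι (p ℕ.^ e)) (sym (ℕₚ.m+[n∸m]≡n l≤L))) (ι-^-+ l (L ℕ.∸ l))

        binom-α : ∀ l → l ℕ.≤ L → ∀ m′ → low m′ l ≡ low (m t) l →
                  binom α m′ ≈ ι (p ℕ.^ carries l) * binomWithCarry (flag l) (θ-at l) (quo m′ l)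
        binom-α l l≤L m′ low≡ = ≈-trans
          (≡⇒≈ (cong₂ binom (α≡low+ l l≤L) (trans (N≡low+p^l*quo m′ l) (cong (ℕ._+ p ℕ.^ l ℕ.* quo m′ l) low≡))))
          (binom-carries l (θ-at-integral l) (quo m′ l))

        m-bounded : m t ℕ.< P
        m-bounded = subst (m t ℕ.<_) (sym P≡Q) (m<Q t)

        low-m≡m : low (m t) L ≡ m t
        low-m≡m = low-m t ℕₚ.≤-refl

        -- As `m t` < P, nothing remains of it after L digits, and the carry-free position L leaves
        -- no pending factor; what survives is C(θ,0) = 1.
        binom-α-top : binom α (m t) ≈ ι (p ℕ.^ carries L) * 1ℚ
        binom-α-top = ≈-trans
          (≡⇒≈ (cong₂ binom (α≡low+ L ℕₚ.≤-refl) (trans (sym low-m≡m) (sym (trans (cong (low (m t) L ℕ.+_) (ℕₚ.*-zeroʳ P)) (ℕₚ.+-identityʳ _))))))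
          (≈-trans (binom-carries L (θ-at-integral L) 0)
          (≡⇒≈ (cong (λ b → ι (p ℕ.^ carries L) * binomWithCarry b (θ-at L) 0) (noFlag t ℕₚ.≤-refl))))

        e : ℕ → ℚ
        e a = sgn a * binom (- α) a

        coeff : ℕ → ℕ → ℚ
        coeff m′ j = sgn m′ * binom α m′ * bracketCoeff (μ (suc r) k d m′) j

        open Convolution r e coeff

        e-integral : ∀ a → Integral (e a)
        e-integral a = *-integral (sgn-integral a) (binom-integral (neg-integral α-integral) a)

        zeta≡f : ∀ n → zetaCoeff (suc r) k d n ≡ Convolution.f r e coeff n
        zeta≡f n = Σ<-cong (suc n) λ a → Σ<-cong (suc n) λ m′ →
          cong (λ z → if r ℕ.* (a ℕ.+ m′) ≤ᵇ n then z else 0ℚ)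
            (solve 5 (λ s b s′ b′ w → s :* b :* s′ :* b′ :* w := s :* b :* (s′ :* b′ :* w)) refl
              (sgn a) (binom (- α) a) (sgn m′) (binom α m′) (bracketCoeff (μ (suc r) k d m′) (n ℕ.∸ r ℕ.* (a ℕ.+ m′))))

        μ-1 : ℕ → ℚ
        μ-1 m′ = μ (suc r) k d m′ - 1ℚ

        μ-1-integral : ∀ m′ → Integral (μ-1 m′)
        μ-1-integral m′ = -‿integral (-‿integral (+-integral (ι-integral 1) (*-integral (ι-integral (suc r)) α-integral))
          (*-integral (ι-integral r) (ι-integral m′))) (ι-integral 1)

        θ′ : ℚ
        θ′ = - (ι y * i)

        θ′-integral : Integral θ′
        θ′-integral = neg-integral (*-integral (ι-integral y) i-integral)

        -- The congruence defining m₀ with its quotient -y/(q+1) made explicit; it makes all L low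
        -- digits of μ - 1 equal to p-1.
        μ≡Pθ′ : μ (suc r) k d (m t) ≡ ι P * θ′
        μ≡Pθ′ = *-cancelʳ-ι q+1 (begin
          (1ℚ + ι (suc r) * α - ι r * ι (m t)) * ι q+1
            ≡⟨ solve 5 (λ q α r m n → (con 1ℚ :+ q :* α :- r :* m) :* n := n :+ q :* (n :* α) :- r :* n :* m) refl (ι (suc r)) α (ι r) (ι (m t)) (ι q+1) ⟩
          ι q+1 + ι (suc r) * (ι q+1 * α) - ι r * ι q+1 * ι (m t)
            ≡⟨ cong₂ (λ u v → ι q+1 + ι (suc r) * u - v) α-eq m-eqℚ ⟩
          ι q+1 + ι (suc r) * ι c - (ι q+1 + ι (suc r) * ι c + ι y * ι P)
            ≡⟨ solve 3 (λ a y P → a :- (a :+ y :* P) := :- (P :* y :* con 1ℚ)) refl (ι q+1 + ι (suc r) * ι c) (ι y) (ι P) ⟩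
          - (ι P * ι y * 1ℚ)
            ≡⟨ cong (λ u → - (ι P * ι y * u)) (sym i*q+1) ⟩
          - (ι P * ι y * (i * ι q+1))
            ≡⟨ solve 4 (λ P y i n → :- (P :* y :* (i :* n)) := P :* :- (y :* i) :* n) refl (ι P) (ι y) i (ι q+1) ⟩
          ι P * θ′ * ι q+1 ∎)
          where
          m-eqℚ : ι r * ι q+1 * ι (m t) ≡ ι q+1 + ι (suc r) * ι c + ι y * ι P
          m-eqℚ = begin
            ι r * ι q+1 * ι (m t)                      ≡⟨ cong (_* ι (m t)) (sym (ι-* r q+1)) ⟩
            ι (r ℕ.* q+1) * ι (m t)                    ≡⟨ sym (ι-* (r ℕ.* q+1) (m t)) ⟩
            ι (r ℕ.* q+1 ℕ.* m t)                      ≡⟨ cong ι (trans (m-eq t) (cong (λ u → q+1 ℕ.+ suc r ℕ.* c ℕ.+ y ℕ.* u) (sym P≡Q))) ⟩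
            ι (q+1 ℕ.+ suc r ℕ.* c ℕ.+ y ℕ.* P)        ≡⟨ ι-+ (q+1 ℕ.+ suc r ℕ.* c) (y ℕ.* P) ⟩
            ι (q+1 ℕ.+ suc r ℕ.* c) + ι (y ℕ.* P)      ≡⟨ cong₂ _+_ (trans (ι-+ q+1 (suc r ℕ.* c)) (cong (_+_ (ι q+1)) (ι-* (suc r) c))) (ι-* y P) ⟩
            ι q+1 + ι (suc r) * ι c + ι y * ι P        ∎

        n : ℕ
        n = ℕ.pred P ℕ.+ r ℕ.* m t

        top : ℚ
        top = ι (p ℕ.^ E) * coeff (m t) (ℕ.pred P)

        p*top-unit : ι p * top ≈ 1ℚ
        p*top-unit = unit-over-p (E ℕ.+ carries L) {Y = Y}
          (subst (λ l → top * ι (p ℕ.^ l) ≈ ι (p ℕ.^ (E ℕ.+ carries L)) * Y) L≡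
            (scaled-term E (carries L) L (sgn (m t)) (bracketCoeff (μ (suc r) k d (m t)) (ℕ.pred P))
              (sgn (suc (ℕ.pred P))) (binom (μ-1 (m t)) (ℕ.pred P)) {W = 1ℚ} (suc (ℕ.pred P))
              (≡⇒≈ (cong ι (ℕₚ.suc-pred P)))
              (bracketCoeff-binom (μ (suc r) k d (m t)) (ℕ.pred P)) binom-α-top))
          (*-cong-≈ (*-cong-≈ (sgn-unit (m t)) (≈-refl {1ℚ})) (*-cong-≈ (sgn-unit (suc (ℕ.pred P)))
            (≈-trans (≡⇒≈ (cong (λ u → binom (u - 1ℚ) (ℕ.pred P)) μ≡Pθ′)) (binom-all-top-digits L θ′-integral))))
          where
          Y : ℚ
          Y = sgn (m t) * 1ℚ * (sgn (suc (ℕ.pred P)) * binom (μ-1 (m t)) (ℕ.pred P))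

        -- Here l = noCarries l + carries l ≤ E + carries l. The bound l ≤ `L′` keeps position L out
        -- of the count, so these summands lose at most p^E.
        other-integral : ∀ {l u} m′ j → suc j ≡ p ℕ.^ l ℕ.* u → ¬ (p ℕ.∣ u) → l ℕ.≤ L′ → low m′ l ≡ low (m t) l →
                         Integral (ι (p ℕ.^ E) * coeff m′ j)
        other-integral {l} {u} m′ j j≡ p∤u l≤L′ low≡ = integral-term E (carries l) l
          (ℕₚ.≤-trans (ℕₚ.≤-reflexive (sym (noCarries+carries l))) (ℕₚ.+-monoˡ-≤ (carries l) (noCarries-mono l≤L′)))
          (scaled-term E (carries l) l (sgn m′) (bracketCoeff (μ (suc r) k d m′) j) (sgn (suc j)) (binom (μ-1 m′) j) (suc j)
            (≈-trans (≡⇒≈ (trans (cong ι j≡) (ι-* (p ℕ.^ l) u)))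
              (≈-trans (*-congˡ-≈ (ι (p ℕ.^ l)) (ι-unit p∤u)) (≡⇒≈ (*-identityʳ _))))
            (bracketCoeff-binom (μ (suc r) k d m′) j)
            (binom-α l (ℕₚ.m≤n⇒m≤1+n l≤L′) m′ low≡))
          (*-integral (*-integral (sgn-integral m′) (binomWithCarry-integral (flag l) (θ-at-integral l) (quo m′ l)))
            (*-integral (sgn-integral (suc j)) (binom-integral (μ-1-integral m′) j)))

        index-sum : ∀ m′ → r ℕ.* m′ ℕ.≤ n → r ℕ.* m′ ℕ.+ suc (n ℕ.∸ r ℕ.* m′) ≡ P ℕ.+ r ℕ.* m t
        index-sum m′ rm′≤n = trans (ℕₚ.+-suc (r ℕ.* m′) _) (trans (cong suc (ℕₚ.m+[n∸m]≡n rm′≤n))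
          (cong (ℕ._+ r ℕ.* m t) (ℕₚ.suc-pred P)))

        p^∣P : ∀ {l} → l ℕ.≤ L → p ℕ.^ l ℕ.∣ P
        p^∣P {l} l≤L = subst (λ e → p ℕ.^ l ℕ.∣ p ℕ.^ e) (ℕₚ.m+[n∸m]≡n l≤L)
          (subst (p ℕ.^ l ℕ.∣_) (sym (ℕₚ.^-distribˡ-+-* p l (L ℕ.∸ l))) (ℕ.m∣m*n (p ℕ.^ (L ℕ.∸ l))))

        gap-below : ∀ {m′} → m′ ℕ.< m t → r ℕ.* m′ ℕ.≤ n → suc (n ℕ.∸ r ℕ.* m′) ≡ P ℕ.+ r ℕ.* (m t ℕ.∸ m′)
        gap-below {m′} m′<m rm′≤n = ℕₚ.+-cancelˡ-≡ (r ℕ.* m′) _ _ (trans (index-sum m′ rm′≤n) (begin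
          P ℕ.+ r ℕ.* m t                                      ≡⟨ cong (λ u → P ℕ.+ r ℕ.* u) (sym (ℕₚ.m+[n∸m]≡n (ℕₚ.<⇒≤ m′<m))) ⟩
          P ℕ.+ r ℕ.* (m′ ℕ.+ (m t ℕ.∸ m′))                    ≡⟨ cong (P ℕ.+_) (ℕₚ.*-distribˡ-+ r m′ _) ⟩
          P ℕ.+ (r ℕ.* m′ ℕ.+ r ℕ.* (m t ℕ.∸ m′))              ≡⟨ sym (ℕₚ.+-assoc P _ _) ⟩
          P ℕ.+ r ℕ.* m′ ℕ.+ r ℕ.* (m t ℕ.∸ m′)                ≡⟨ cong (ℕ._+ r ℕ.* (m t ℕ.∸ m′)) (ℕₚ.+-comm P (r ℕ.* m′)) ⟩
          r ℕ.* m′ ℕ.+ P ℕ.+ r ℕ.* (m t ℕ.∸ m′)                ≡⟨ ℕₚ.+-assoc (r ℕ.* m′) P _ ⟩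
          r ℕ.* m′ ℕ.+ (P ℕ.+ r ℕ.* (m t ℕ.∸ m′))              ∎))

        gap-above : ∀ {m′} → m t ℕ.< m′ → r ℕ.* m′ ℕ.≤ n → r ℕ.* (m′ ℕ.∸ m t) ℕ.+ suc (n ℕ.∸ r ℕ.* m′) ≡ P
        gap-above {m′} m<m′ rm′≤n = ℕₚ.+-cancelˡ-≡ (r ℕ.* m t) _ _ (begin
          r ℕ.* m t ℕ.+ (r ℕ.* (m′ ℕ.∸ m t) ℕ.+ i′)            ≡⟨ sym (ℕₚ.+-assoc (r ℕ.* m t) _ i′) ⟩
          r ℕ.* m t ℕ.+ r ℕ.* (m′ ℕ.∸ m t) ℕ.+ i′              ≡⟨ cong (ℕ._+ i′) (sym (ℕₚ.*-distribˡ-+ r (m t) _)) ⟩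
          r ℕ.* (m t ℕ.+ (m′ ℕ.∸ m t)) ℕ.+ i′                  ≡⟨ cong (λ u → r ℕ.* u ℕ.+ i′) (ℕₚ.m+[n∸m]≡n (ℕₚ.<⇒≤ m<m′)) ⟩
          r ℕ.* m′ ℕ.+ i′                                      ≡⟨ index-sum m′ rm′≤n ⟩
          P ℕ.+ r ℕ.* m t                                      ≡⟨ ℕₚ.+-comm P _ ⟩
          r ℕ.* m t ℕ.+ P                                      ∎)
          where i′ = suc (n ℕ.∸ r ℕ.* m′)

        P∤small : ∀ {z} → 0 ℕ.< z → z ℕ.< P → ¬ (P ℕ.∣ z)
        P∤small 0<z z<P P∣z = ℕₚ.<⇒≱ z<P (ℕ.∣⇒≤ {{ℕ.>-nonZero 0<z}} P∣z)

        -- Below `m t` the index is P plus r times a difference strictly between 0 and P, with r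
        -- prime to p; above `m t` the index itself lies strictly between 0 and P.
        P∤index : ∀ {m′} → m′ ≢ m t → r ℕ.* m′ ℕ.≤ n → ¬ (P ℕ.∣ suc (n ℕ.∸ r ℕ.* m′))
        P∤index {m′} m′≢m rm′≤n P∣ with ℕₚ.<-cmp m′ (m t)
        ... | tri≈ _ m′≡m _ = m′≢m m′≡m
        ... | tri< m′<m _ _ = P∤small (ℕₚ.m<n⇒0<n∸m m′<m) (ℕₚ.≤-<-trans (ℕₚ.m∸n≤m (m t) m′) m-bounded)
          (p^∣-cancel p∤r L (ℕ.∣m+n∣m⇒∣n (subst (P ℕ.∣_) (gap-below m′<m rm′≤n) P∣) ℕ.∣-refl))
        ... | tri> _ _ m<m′ = P∤small (s≤s z≤n)
          (subst (suc (n ℕ.∸ r ℕ.* m′) ℕ.<_) (gap-above m<m′ rm′≤n)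
            (ℕₚ.m<n+m _ (ℕₚ.≤-trans (ℕₚ.m<n⇒0<n∸m m<m′) (ℕₚ.m≤n*m _ r)))) P∣

        -- The index differs from P by r times the distance of m′ from `m t`, and p does not divide
        -- r; so a power of p in the index forces agreement of low digits, hence the same low
        -- carries.
        low-other : ∀ {l m′} → l ℕ.≤ L → r ℕ.* m′ ℕ.≤ n → p ℕ.^ l ℕ.∣ suc (n ℕ.∸ r ℕ.* m′) → low m′ l ≡ low (m t) l
        low-other {l} {m′} l≤L rm′≤n p^l∣ with ℕₚ.<-cmp m′ (m t)
        ... | tri≈ _ m′≡m _ = cong (λ u → low u l) m′≡m
        ... | tri< m′<m _ _ = sym (low-cong l (ℕₚ.<⇒≤ m′<m)
          (p^∣-cancel p∤r l (ℕ.∣m+n∣m⇒∣n (subst (p ℕ.^ l ℕ.∣_) (gap-below m′<m rm′≤n) p^l∣) (p^∣P l≤L))))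
        ... | tri> _ _ m<m′ = low-cong l (ℕₚ.<⇒≤ m<m′)
          (p^∣-cancel p∤r l (ℕ.∣m+n∣m⇒∣n (subst (p ℕ.^ l ℕ.∣_) (trans (sym (gap-above m<m′ rm′≤n)) (ℕₚ.+-comm _ (suc (n ℕ.∸ r ℕ.* m′)))) (p^∣P l≤L)) p^l∣))

        P∣p^ : ∀ {l} → L ℕ.≤ l → P ℕ.∣ p ℕ.^ l
        P∣p^ {l} L≤l = subst (λ e → P ℕ.∣ p ℕ.^ e) (ℕₚ.m+[n∸m]≡n L≤l)
          (subst (P ℕ.∣_) (sym (ℕₚ.^-distribˡ-+-* p L (l ℕ.∸ L))) (ℕ.m∣m*n (p ℕ.^ (l ℕ.∸ L))))

        others : ∀ m′ → m′ ≢ m t → r ℕ.* m′ ℕ.≤ n → Integral (ι (p ℕ.^ E) * coeff m′ (n ℕ.∸ r ℕ.* m′))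
        others m′ m′≢m rm′≤n = split (p-part (suc (n ℕ.∸ r ℕ.* m′)))
          where
          split : (∃₂ λ l u → suc (n ℕ.∸ r ℕ.* m′) ≡ p ℕ.^ l ℕ.* u × ¬ (p ℕ.∣ u)) →
                  Integral (ι (p ℕ.^ E) * coeff m′ (n ℕ.∸ r ℕ.* m′))
          split (l , u , index≡ , p∤u) = [ low-valuation , high-valuation ]′ (ℕₚ.≤-<-connex l L′)
            where
            low-valuation : l ℕ.≤ L′ → Integral (ι (p ℕ.^ E) * coeff m′ (n ℕ.∸ r ℕ.* m′))
            low-valuation l≤L′ = other-integral m′ (n ℕ.∸ r ℕ.* m′) index≡ p∤u l≤L′
              (low-other (ℕₚ.m≤n⇒m≤1+n l≤L′) rm′≤n (subst (p ℕ.^ l ℕ.∣_) (sym index≡) (ℕ.m∣m*n u)))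
            high-valuation : L ℕ.≤ l → Integral (ι (p ℕ.^ E) * coeff m′ (n ℕ.∸ r ℕ.* m′))
            high-valuation L≤l = ⊥-elim (P∤index m′≢m rm′≤n (subst (P ℕ.∣_) (sym index≡) (ℕ.∣-trans (P∣p^ L≤l) (ℕ.m∣m*n u))))

        g-nonintegral : ¬ Integral (ι (p ℕ.^ E) * g n)
        g-nonintegral ig = p*integral-nonunit top-integral p*top-unit
          where
          term : ℕ → ℚ
          term m′ = if r ℕ.* m′ ≤ᵇ n then coeff m′ (n ℕ.∸ r ℕ.* m′) else 0ℚ
          term-integral : ∀ m′ → m′ ℕ.< suc n → m′ ≢ m t → Integral (ι (p ℕ.^ E) * term m′)
          term-integral m′ _ m′≢m = split (r ℕ.* m′ ℕ.≤? n)
            where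
            split : Dec (r ℕ.* m′ ℕ.≤ n) → Integral (ι (p ℕ.^ E) * term m′)
            split (yes rm′≤n) = subst Integral (cong (ι (p ℕ.^ E) *_) (sym (if-true (ℕₚ.≤⇒≤ᵇ rm′≤n)))) (others m′ m′≢m rm′≤n)
            split (no  rm′≰n) = subst Integral
              (sym (trans (cong (ι (p ℕ.^ E) *_) (if-false λ h → rm′≰n (ℕₚ.≤ᵇ⇒≤ _ _ h))) (*-zeroʳ (ι (p ℕ.^ E))))) (ι-integral 0)
          rm≤n : r ℕ.* m t ℕ.≤ n
          rm≤n = ℕₚ.m≤n+m (r ℕ.* m t) (ℕ.pred P)
          m<sn : m t ℕ.< suc n
          m<sn = s≤s (ℕₚ.≤-trans (ℕₚ.m≤n*m (m t) r) rm≤n)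
          top-integral : Integral top
          top-integral = subst Integral
            (cong (ι (p ℕ.^ E) *_) (trans (if-true (ℕₚ.≤⇒≤ᵇ rm≤n)) (cong (coeff (m t)) (ℕₚ.m+n∸n≡m (ℕ.pred P) (r ℕ.* m t)))))
            (Σ<-isolate (suc n) {λ m′ → ι (p ℕ.^ E) * term m′} m<sn term-integral
              (subst Integral (Σ<-* (suc n) (ι (p ℕ.^ E)) term) ig))

        Unbounded : ℕ → Set
        Unbounded n′ = p ℕ.^ B ℕ.∣ ℚ.denominatorℕ (zetaCoeff (suc r) k d n′)

        ¬all-bounded : ¬ (∃ λ n′ → n′ ℕ.< suc n × Unbounded n′) → ⊥
        -- Bounded coefficients of ζ make p^B g integral; since B ≤ E, multiplying by p^(E-B)
        -- reaches the exponent that has been refuted.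
        ¬all-bounded none = g-nonintegral (subst Integral rescale (*-integral (ι-integral (p ℕ.^ (E ℕ.∸ B)))
          (deconvolve {ι (p ℕ.^ B)} refl e-integral (suc n) f-integral n ℕₚ.≤-refl)))
          where
          f-integral : ∀ n′ → n′ ℕ.< suc n → Integral (ι (p ℕ.^ B) * Convolution.f r e coeff n′)
          f-integral n′ n′<sn = subst (λ z → Integral (ι (p ℕ.^ B) * z)) (zeta≡f n′)
            (p^B∤den⇒integral B (zetaCoeff (suc r) k d n′) (λ h → none (n′ , n′<sn , h)))
          rescale : ι (p ℕ.^ (E ℕ.∸ B)) * (ι (p ℕ.^ B) * g n) ≡ ι (p ℕ.^ E) * g n
          rescale = trans (sym (*-assoc (ι (p ℕ.^ (E ℕ.∸ B))) (ι (p ℕ.^ B)) (g n)))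
            (cong (_* g n) (trans (sym (ι-^-+ (E ℕ.∸ B) B)) (cong (λ w → ι (p ℕ.^ w)) (ℕₚ.m∸n+n≡m B≤E))))

        -- The contradiction involves only indices up to n, where divisibility is decidable, so a
        -- finite search turns it into a witness.
        unbounded : ∃ Unbounded
        unbounded = search (ℕₚ.anyUpTo? (λ n′ → p ℕ.^ B ℕ.∣? ℚ.denominatorℕ (zetaCoeff (suc r) k d n′)) (suc n))
          where
          search : Dec (∃ λ n′ → n′ ℕ.< suc n × Unbounded n′) → ∃ Unbounded
          search (yes (n′ , _ , h)) = n′ , h
          search (no  none)         = ⊥-elim (¬all-bounded none)

-- Specialisation to α = k/d

open import Defs
open import Data.Nat using (ℕ; suc; _+_; _^_; _≤_; _<_; NonZero)
open import Data.Nat.Divisibility using (_∣_)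
open import Data.Nat.Primality using (Prime; prime⇒nonZero; prime⇒nonTrivial)
open import Data.Rational using (ℚ)
open import Data.Product using (∃)

import Data.Nat as ℕ
import Data.Nat.Properties as ℕₚ
import Data.Nat.Divisibility as ℕ
import Data.Rational as ℚ
import Data.Rational.Properties as ℚₚ
open import Relation.Binary.PropositionalEquality
open ≡-Reasoning
open Integrality using (ι-*; n/d*d; module Core)
open CarryFreeLevels using (seed)

-- On ℚ the absolute value of K is p-adic, and π_F scales all coefficients by one nonzero constant;
-- so unboundedness of ζ means arbitrarily high powers of p in the denominators of ζ/π_F.
theorem6p3p18 : (p f : ℕ) → Prime p → (d : ℕ) → .{{_ : NonZero d}} →
    d ∣ (p ^ suc f) + 1 → (k : ℕ) → 1 ≤ k → k < d →
    (B : ℕ) → ∃ λ n → p ^ B ∣ ℚ.denominatorℕ (zetaCoeff (p ^ suc f) k d n)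
theorem6p3p18 p f p-prime d (ℕ.divides e q+1≡) k 1≤k k<d B =
  subst (λ q → ∃ λ n → p ^ B ∣ ℚ.denominatorℕ (zetaCoeff q k d n)) (sym q≡)
    (Core.Level.unbounded p p-prime f r c q≡ (seed r c 1≤r 1≤c c≤q) k d α-eq B)
  where
  instance
    p≢0 : NonZero p
    p≢0 = prime⇒nonZero p-prime

  r c : ℕ
  r = ℕ.pred (p ^ suc f)
  -- The numerator of k/d over the denominator q+1 = e d; k < d gives c ≤ q, the range covered by
  -- `seed`.
  c = e ℕ.* k

  q≡ : p ^ suc f ≡ suc r
  q≡ = sym (ℕₚ.suc-pred (p ^ suc f) {{ℕₚ.m^n≢0 p (suc f)}})

  e*d≡ : suc (suc r) ≡ e ℕ.* d
  e*d≡ = trans (cong suc (sym q≡)) (trans (ℕₚ.+-comm 1 (p ^ suc f)) q+1≡)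

  instance
    e≢0 : NonZero e
    e≢0 = ℕₚ.m*n≢0⇒m≢0 e {{subst NonZero e*d≡ _}}

  1≤r : 1 ≤ r
  1≤r = ℕₚ.≤-pred (subst (2 ≤_) q≡ (ℕₚ.≤-trans (ℕ.nonTrivial⇒n>1 p {{prime⇒nonTrivial p-prime}})
    (ℕₚ.m≤m*n p (p ^ f) {{ℕₚ.m^n≢0 p f}})))

  instance
    r≢0 : NonZero r
    r≢0 = ℕ.>-nonZero 1≤r

  1≤c : 1 ≤ c
  1≤c = ℕₚ.≤-trans 1≤k (ℕₚ.m≤n*m k e)

  c≤q : c ≤ suc r
  c≤q = ℕₚ.≤-pred (subst (c <_) (sym e*d≡) (ℕₚ.*-monoʳ-< e k<d))

  α-eq : ι (suc (suc r)) ℚ.* frac k d ≡ ι c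
  α-eq = begin
    ι (suc (suc r)) ℚ.* frac k d      ≡⟨ cong (λ t → ι t ℚ.* frac k d) e*d≡ ⟩
    ι (e ℕ.* d) ℚ.* frac k d          ≡⟨ cong (ℚ._* frac k d) (ι-* e d) ⟩
    ι e ℚ.* ι d ℚ.* frac k d          ≡⟨ ℚₚ.*-assoc (ι e) (ι d) (frac k d) ⟩
    ι e ℚ.* (ι d ℚ.* frac k d)        ≡⟨ cong (ι e ℚ.*_) (trans (ℚₚ.*-comm (ι d) (frac k d)) (n/d*d k d)) ⟩
    ι e ℚ.* ι k                       ≡⟨ sym (ι-* e k) ⟩
    ι c                               ∎
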